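{- Let $a,b\in\mathbb{Z}$ with $a\neq 0$, let $d(x)=ax+b$ and $g(x)=1$, and let $(\mathcal{F}_n(x))_{n\ge 0}$ be the Fibonacci-type polynomial sequence determined by $d(x)$ and $g(x)$. If $p$ is a prime number, then $\mathcal{F}_p(x)$ is irreducible over $\mathbb{Q}$.
   Context: The Fibonacci-type polynomial sequence determined by $d(x),g(x)\in\mathbb{Z}[x]$ is defined by $\mathcal{F}_0(x)=0$, $\mathcal{F}_1(x)=1$, and $\mathcal{F}_n(x)=d(x)\mathcal{F}_{n-1}(x)+g(x)\mathcal{F}_{n-2}(x)$ for $n\ge 2$. -}

module Defs where

open import Algebra.Bundles.Raw using (RawRing)
import Algebra.Definitions.RawSemiring as RawSemiringDefinitions
open import Data.Integer.Base as ℤ using (ℤ)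
open import Data.List.Base using (List; []; _∷_; map)
open import Data.Nat.Base using (ℕ; zero; suc)
open import Data.Rational.Base as ℚ using (ℚ)

-- A polynomial is its list of coefficients, constant term first.  Lists are
-- not required to be normalised: polynomials are compared coefficientwise,
-- so trailing zeros are irrelevant.
module Polynomial {c ℓ} (R : RawRing c ℓ) where

  private module R = RawRing R

  Poly : Set c
  Poly = List R.Carrier

  coeff : Poly → ℕ → R.Carrier
  coeff []      _       = R.0#
  coeff (a ∷ p) zero    = a
  coeff (a ∷ p) (suc n) = coeff p n

  infix  4 _≈_
  infixl 6 _+_
  infixl 7 _*_ _·_
  infix  8 -_

  record _≈_ (p q : Poly) : Set ℓ where
    constructor mk≈
    field
      coeff-≈ : ∀ n → coeff p n R.≈ coeff q n

  open _≈_ public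

  C : R.Carrier → Poly
  C a = a ∷ []

  X : Poly
  X = R.0# ∷ R.1# ∷ []

  _+_ : Poly → Poly → Poly
  []      + q       = q
  (a ∷ p) + []      = a ∷ p
  (a ∷ p) + (b ∷ q) = (a R.+ b) ∷ (p + q)

  -_ : Poly → Poly
  - p = map R.-_ p

  _·_ : R.Carrier → Poly → Poly
  a · p = map (a R.*_) p

  -- (a + x p) q = a q + x (p q)
  _*_ : Poly → Poly → Poly
  []      * q = []
  (a ∷ p) * q = a · q + (R.0# ∷ p * q)

  rawRing : RawRing c ℓ
  rawRing = record
    { Carrier = Poly
    ; _≈_     = _≈_
    ; _+_     = _+_
    ; _*_     = _*_
    ; -_      = -_
    ; 0#      = []
    ; 1#      = C R.1#
    }

module ℤ[x] = Polynomial ℤ.+-*-rawRing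
module ℚ[x] = Polynomial ℚ.+-*-rawRing

fibonacciType : (d g : ℤ[x].Poly) → ℕ → ℤ[x].Poly
fibonacciType d g zero          = RawRing.0# ℤ[x].rawRing
fibonacciType d g (suc zero)    = RawRing.1# ℤ[x].rawRing
fibonacciType d g (suc (suc n)) =
  d ℤ[x].* fibonacciType d g (suc n) ℤ[x].+ g ℤ[x].* fibonacciType d g n

toℚ[x] : ℤ[x].Poly → ℚ[x].Poly
toℚ[x] = map (ℚ._/ 1)

-- The library's Irreducible in the ring ℚ[x], whose units are the divisors
-- of 1; zero is excluded because 0 ≈ 0 * 0 while 0 does not divide 1.
IrreducibleOverℚ : ℤ[x].Poly → Set
IrreducibleOverℚ f = Irreducible (toℚ[x] f)
  where
  open RawSemiringDefinitions (RawRing.rawSemiring ℚ[x].rawRing)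
    using (Irreducible)

{-# OPTIONS --safe #-}
module Submission where

-- Write t = ax + b and s = t², so that ℚ[x] = ℚ[w][t]/(t² = s) with w = s + 4.
-- There F₂ₙ₊₁ = P n is a polynomial in w, and F₂ₙ = t Q n.
--
-- The coefficient of wʲ in P n is ± (2n+1)/(2j+1) · (n+j choose 2j), so for
-- p = 2n + 1 prime P n is an Eisenstein polynomial in w; in particular it is
-- irreducible, hence prime, in ℚ[w].  If Fₚ = xy, the norms from ℚ[w][t] to
-- ℚ[w] satisfy N(x) N(y) = N(Fₚ) = (P n)², so either N(x) or N(y) is a unit,
-- and with it x or y, or say N(x) = c · P n.  In that case, setting w = 4
-- shows that c is a square, and clearing denominators gives integer
-- polynomials with E² − sO² = e² P n.  But F₂ₙ₊₁ = Fₙ² + Fₙ₊₁² says that P n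
-- has the form A² + sB² with B odd at some coefficient.  Modulo 2, where
-- s = w, squares determine their root and are linearly independent over w; so
-- for odd e one gets E ≡ eA and O ≡ eB, and comparing modulo 4 makes 2sB²
-- divisible by 4, which is absurd.  For even e, 2 divides E and O as well and
-- one descends.
--
-- For p = 2 the norm of F₂ = t is −s, of degree 1.

open import Defs
open import Algebra.Bundles using (CommutativeRing)
open import Algebra.Bundles.Raw using (RawRing)
import Algebra.Definitions.RawSemiring as RawSemiringDefinitions
import Algebra.Morphism.Construct.Composition as Composition
import Algebra.Morphism.Construct.Identity as Identity
open import Algebra.Morphism.Structures using (module RingMorphisms)
import Algebra.Properties.AbelianGroup as AbelianGroupProperties
import Algebra.Properties.Ring as RingProperties
open import Algebra.Solver.Ring.AlmostCommutativeRing using (fromCommutativeRing; _-Raw-AlmostCommutative⟶_)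
open import Data.Empty using (⊥; ⊥-elim)
open import Data.Integer.Base as ℤ using (ℤ; 0ℤ; 1ℤ; +_; -[1+_]; _⊖_)
import Data.Integer.Properties as ℤₚ
open import Data.List.Base using ([]; _∷_; map)
open import Data.Maybe.Base using (Maybe; just; nothing)
open import Data.Nat.Base as ℕ using (ℕ; zero; suc; _≤_; _<_; z≤n; s≤s)
open import Data.Nat.Combinatorics using (nCk+nC[k+1]≡[n+1]C[k+1]; nC1≡n; nCn≡1; k>n⇒nCk≡0) renaming (_C_ to _choose_)
import Data.Nat.Divisibility as ℕ
open import Data.Nat.Induction using (<-wellFounded)
open import Data.Nat.Primality using (Prime; euclidsLemma; prime⇒nonTrivial; prime⇒nonZero; prime⇒irreducible; prime[2]; ¬prime[0]; ¬prime[1])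
import Data.Nat.Properties as ℕₚ
import Data.Nat.Solver as ℕ
open import Data.Product.Base using (_×_; _,_; proj₁; proj₂; ∃)
open import Data.Rational.Base as ℚ using (ℚ; 0ℚ; 1ℚ; mkℚ)
import Data.Rational.Properties as ℚₚ
open import Data.Rational.Unnormalised.Base as ℚᵘ using (mkℚᵘ; *≡*)
import Data.Rational.Unnormalised.Properties as ℚᵘₚ
open import Data.Sum.Base as Sum using (_⊎_; inj₁; inj₂; [_,_]′)
open import Function.Base using (_∘_; id)
open import Induction.WellFounded using (Acc; acc)
open import Level using (0ℓ)
import Relation.Binary.Reasoning.Setoid as SetoidReasoning
open import Relation.Binary.PropositionalEquality as ≡ using (_≡_; _≢_)
open import Relation.Nullary using (¬_; Dec; yes; no; contradiction)

-- The variable w = d² + 4 is the discriminant of the recurrence. For an odd prime p one has Fₚ ≡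
-- w^((p-1)/2) modulo p, so powers of w are the basis in which an Eisenstein polynomial can be
-- expected; in powers of s the constant coefficient of P n is 1, and the criterion says nothing.
-- Irreducibility in ℚ[w] does not pass to ℚ[x] by itself, because w is quadratic in x. A
-- factorisation of Fₚ into a polynomial and, up to a scalar, its conjugate under t ↦ -t would be
-- invisible in ℚ[w] except for making P n a multiple of a norm E² - sO². The parity argument exists
-- to exclude exactly this case. It rests on a sign: the sum of two squares of Fibonacci polynomials
-- gives A² + sB², which agrees with a norm modulo 2 but differs from it by 2sB², and this is what
-- reduction modulo 4 detects.

-- Solving ring identities with integer numerals.

module IntegerCoefficientSolver (R : CommutativeRing 0ℓ 0ℓ) where
  open CommutativeRing R
  open import Algebra.Properties.Ring ring
  open import Algebra.Properties.AbelianGroup +-abelianGroup using (⁻¹-∙-comm)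
  open import Algebra.Properties.CommutativeSemigroup +-commutativeSemigroup using (interchange)
  open import Algebra.Properties.Semiring.Mult.TCOptimised semiring using (×-homo-+; ×1-homo-*) renaming (_×_ to _×ₙ_)
  open import Relation.Binary.Reasoning.Setoid setoid

  -- Numerals are multiples of `1#` in the form where `1 ×ₙ 1#` computes to `1#`. Thus `con (+ 2)`
  -- evaluates to `1# + 1#`, which for integer polynomials computes to `C (+ 2)`.
  fromℤ : ℤ → Carrier
  fromℤ (+ n)    = n ×ₙ 1#
  fromℤ -[1+ n ] = - (suc n ×ₙ 1#)

  private
    ×1-suc : ∀ n → suc n ×ₙ 1# ≈ 1# + n ×ₙ 1#
    ×1-suc n = ×-homo-+ 1# 1 n

    fromℤ-⊖ : ∀ m n → fromℤ (m ⊖ n) ≈ m ×ₙ 1# - n ×ₙ 1#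
    fromℤ-⊖ m zero = sym (trans (+-congˡ -0#≈0#) (+-identityʳ _))
    fromℤ-⊖ zero (suc n) = sym (+-identityˡ _)
    fromℤ-⊖ (suc m) (suc n) = begin
      fromℤ (suc m ⊖ suc n)                    ≡⟨ ≡.cong fromℤ (ℤₚ.[1+m]⊖[1+n]≡m⊖n m n) ⟩
      fromℤ (m ⊖ n)                            ≈⟨ fromℤ-⊖ m n ⟩
      m ×ₙ 1# - n ×ₙ 1#                          ≈⟨ +-identityˡ _ ⟨
      0# + (m ×ₙ 1# - n ×ₙ 1#)                   ≈⟨ +-congʳ (-‿inverseʳ 1#) ⟨
      (1# - 1#) + (m ×ₙ 1# - n ×ₙ 1#)            ≈⟨ interchange _ _ _ _ ⟩
      (1# + m ×ₙ 1#) + (- 1# - n ×ₙ 1#)          ≈⟨ +-congˡ (⁻¹-∙-comm _ _) ⟩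
      (1# + m ×ₙ 1#) - (1# + n ×ₙ 1#)            ≈⟨ +-cong (×1-suc m) (-‿cong (×1-suc n)) ⟨
      suc m ×ₙ 1# - suc n ×ₙ 1#                  ∎

    fromℤ-neg : ∀ i → fromℤ (ℤ.- i) ≈ - fromℤ i
    fromℤ-neg (+ zero)  = sym -0#≈0#
    fromℤ-neg (+ suc n) = refl
    fromℤ-neg -[1+ n ]  = sym (-‿involutive _)

    fromℤ-+ : ∀ i j → fromℤ (i ℤ.+ j) ≈ fromℤ i + fromℤ j
    fromℤ-+ (+ m)    (+ n)    = ×-homo-+ 1# m n
    fromℤ-+ (+ m)    -[1+ n ] = fromℤ-⊖ m (suc n)
    fromℤ-+ -[1+ m ] (+ n)    = trans (fromℤ-⊖ n (suc m)) (+-comm _ _)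
    fromℤ-+ -[1+ m ] -[1+ n ] = begin
      - (suc (suc (m ℕ.+ n)) ×ₙ 1#)         ≡⟨ ≡.cong (λ k → - (k ×ₙ 1#)) (ℕₚ.+-suc (suc m) n) ⟨
      - ((suc m ℕ.+ suc n) ×ₙ 1#)           ≈⟨ -‿cong (×-homo-+ 1# (suc m) (suc n)) ⟩
      - (suc m ×ₙ 1# + suc n ×ₙ 1#)          ≈⟨ ⁻¹-∙-comm _ _ ⟨
      - (suc m ×ₙ 1#) - suc n ×ₙ 1#          ∎

    fromℤ-*⁺ : ∀ m n → fromℤ (+ m ℤ.* + n) ≈ m ×ₙ 1# * n ×ₙ 1#
    fromℤ-*⁺ m n = trans (reflexive (≡.cong fromℤ (≡.sym (ℤₚ.pos-* m n)))) (×1-homo-* m n)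

    -- As `ℤ.- (+ suc m)` computes to `-[1+ m ]`, this and commutativity reduce every sign pattern
    -- to the product of two nonnegative integers.
    fromℤ-neg-* : ∀ i j → fromℤ (i ℤ.* j) ≈ fromℤ i * fromℤ j →
                  fromℤ (ℤ.- i ℤ.* j) ≈ fromℤ (ℤ.- i) * fromℤ j
    fromℤ-neg-* i j eq = begin
      fromℤ (ℤ.- i ℤ.* j)        ≡⟨ ≡.cong fromℤ (ℤₚ.neg-distribˡ-* i j) ⟨
      fromℤ (ℤ.- (i ℤ.* j))      ≈⟨ fromℤ-neg (i ℤ.* j) ⟩
      - fromℤ (i ℤ.* j)          ≈⟨ -‿cong eq ⟩
      - (fromℤ i * fromℤ j)      ≈⟨ -‿distribˡ-* _ _ ⟩
      - fromℤ i * fromℤ j        ≈⟨ *-congʳ (fromℤ-neg i) ⟨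
      fromℤ (ℤ.- i) * fromℤ j    ∎

    fromℤ-*-comm : ∀ i j → fromℤ (i ℤ.* j) ≈ fromℤ i * fromℤ j →
                   fromℤ (j ℤ.* i) ≈ fromℤ j * fromℤ i
    fromℤ-*-comm i j eq =
      trans (reflexive (≡.cong fromℤ (ℤₚ.*-comm j i))) (trans eq (*-comm _ _))

    fromℤ-* : ∀ i j → fromℤ (i ℤ.* j) ≈ fromℤ i * fromℤ j
    fromℤ-* (+ m)    (+ n)    = fromℤ-*⁺ m n
    fromℤ-* -[1+ m ] (+ n)    = fromℤ-neg-* (+ suc m) (+ n) (fromℤ-*⁺ (suc m) n)
    fromℤ-* (+ m)    -[1+ n ] =
      fromℤ-*-comm -[1+ n ] (+ m) (fromℤ-neg-* (+ suc n) (+ m) (fromℤ-*⁺ (suc n) m))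
    fromℤ-* -[1+ m ] -[1+ n ] =
      fromℤ-neg-* (+ suc m) -[1+ n ]
        (fromℤ-*-comm -[1+ n ] (+ suc m) (fromℤ-neg-* (+ suc n) (+ suc m) (fromℤ-*⁺ (suc n) (suc m))))

    morphism : ℤ.+-*-rawRing -Raw-AlmostCommutative⟶ fromCommutativeRing R
    morphism = record
      { ⟦_⟧    = fromℤ
      ; +-homo = fromℤ-+
      ; *-homo = fromℤ-*
      ; -‿homo = fromℤ-neg
      ; 0-homo = refl
      ; 1-homo = refl
      }

    weaklyDecide : ∀ i j → Maybe (fromℤ i ≈ fromℤ j)
    weaklyDecide i j with i ℤₚ.≟ j
    ... | yes ≡.refl = just refl
    ... | no _       = nothing

  open import Algebra.Solver.Ring ℤ.+-*-rawRing (fromCommutativeRing R) morphism weaklyDecide public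
    using (solve; con; _:=_; _:+_; _:*_; _:-_; :-_)

-- The polynomial ring over a commutative ring.

module PolynomialRing (R : CommutativeRing 0ℓ 0ℓ) where
  private module R = CommutativeRing R
  open import Algebra.Properties.Ring R.ring using (-0#≈0#)
  open import Algebra.Properties.CommutativeSemigroup R.+-commutativeSemigroup using (interchange)
  open Polynomial R.rawRing public

  coeff-+ : ∀ p q n → coeff (p + q) n R.≈ coeff p n R.+ coeff q n
  coeff-+ []      q       n       = R.sym (R.+-identityˡ _)
  coeff-+ (a ∷ p) []      n       = R.sym (R.+-identityʳ _)
  coeff-+ (a ∷ p) (b ∷ q) zero    = R.refl
  coeff-+ (a ∷ p) (b ∷ q) (suc n) = coeff-+ p q n

  coeff-· : ∀ a p n → coeff (a · p) n R.≈ a R.* coeff p n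
  coeff-· a []      n       = R.sym (R.zeroʳ a)
  coeff-· a (b ∷ p) zero    = R.refl
  coeff-· a (b ∷ p) (suc n) = coeff-· a p n

  coeff-neg : ∀ p n → coeff (- p) n R.≈ R.- coeff p n
  coeff-neg []      n       = R.sym -0#≈0#
  coeff-neg (a ∷ p) zero    = R.refl
  coeff-neg (a ∷ p) (suc n) = coeff-neg p n

  ≈-refl : ∀ {p} → p ≈ p
  ≈-refl .coeff-≈ n = R.refl

  ≈-sym : ∀ {p q} → p ≈ q → q ≈ p
  ≈-sym p≈q .coeff-≈ n = R.sym (coeff-≈ p≈q n)

  ≈-trans : ∀ {p q r} → p ≈ q → q ≈ r → p ≈ r
  ≈-trans p≈q q≈r .coeff-≈ n = R.trans (coeff-≈ p≈q n) (coeff-≈ q≈r n)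

  ∷-cong : ∀ {a b p q} → a R.≈ b → p ≈ q → a ∷ p ≈ b ∷ q
  ∷-cong a≈b p≈q .coeff-≈ zero    = a≈b
  ∷-cong a≈b p≈q .coeff-≈ (suc n) = coeff-≈ p≈q n

  0∷[]≈[] : R.0# ∷ [] ≈ []
  0∷[]≈[] .coeff-≈ zero    = R.refl
  0∷[]≈[] .coeff-≈ (suc n) = R.refl

  tail-≈ : ∀ {a b p q} → a ∷ p ≈ b ∷ q → p ≈ q
  tail-≈ eq .coeff-≈ n = coeff-≈ eq (suc n)

  ∷≈[]⇒tail≈[] : ∀ {a p} → a ∷ p ≈ [] → p ≈ []
  ∷≈[]⇒tail≈[] eq .coeff-≈ n = coeff-≈ eq (suc n)

  +-cong : ∀ {p p′ q q′} → p ≈ p′ → q ≈ q′ → p + q ≈ p′ + q′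
  +-cong {p} {p′} {q} {q′} e f .coeff-≈ n =
    R.trans (coeff-+ p q n) (R.trans (R.+-cong (coeff-≈ e n) (coeff-≈ f n)) (R.sym (coeff-+ p′ q′ n)))

  +-congˡ : ∀ p {q q′} → q ≈ q′ → p + q ≈ p + q′
  +-congˡ p = +-cong (≈-refl {p})

  +-congʳ : ∀ {p p′} q → p ≈ p′ → p + q ≈ p′ + q
  +-congʳ q e = +-cong e (≈-refl {q})

  +-assoc : ∀ p q r → (p + q) + r ≈ p + (q + r)
  +-assoc p q r .coeff-≈ n = begin
    coeff (p + q + r) n                             ≈⟨ coeff-+ (p + q) r n ⟩
    coeff (p + q) n R.+ coeff r n                   ≈⟨ R.+-congʳ (coeff-+ p q n) ⟩
    coeff p n R.+ coeff q n R.+ coeff r n           ≈⟨ R.+-assoc _ _ _ ⟩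
    coeff p n R.+ (coeff q n R.+ coeff r n)         ≈⟨ R.+-congˡ (coeff-+ q r n) ⟨
    coeff p n R.+ coeff (q + r) n                   ≈⟨ coeff-+ p (q + r) n ⟨
    coeff (p + (q + r)) n                           ∎
    where open import Relation.Binary.Reasoning.Setoid R.setoid

  +-comm : ∀ p q → p + q ≈ q + p
  +-comm p q .coeff-≈ n = R.trans (coeff-+ p q n) (R.trans (R.+-comm _ _) (R.sym (coeff-+ q p n)))

  +-identityʳ : ∀ p → p + [] ≈ p
  +-identityʳ p = +-comm p []

  -‿cong : ∀ {p q} → p ≈ q → - p ≈ - q
  -‿cong {p} {q} e .coeff-≈ n =
    R.trans (coeff-neg p n) (R.trans (R.-‿cong (coeff-≈ e n)) (R.sym (coeff-neg q n)))

  -‿inverseʳ : ∀ p → p + - p ≈ []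
  -‿inverseʳ p .coeff-≈ n =
    R.trans (coeff-+ p (- p) n) (R.trans (R.+-congˡ (coeff-neg p n)) (R.-‿inverseʳ _))

  +-interchange : ∀ p q r s → (p + q) + (r + s) ≈ (p + r) + (q + s)
  +-interchange p q r s .coeff-≈ n = begin
    coeff (p + q + (r + s)) n                                        ≈⟨ coeff-+ (p + q) (r + s) n ⟩
    coeff (p + q) n R.+ coeff (r + s) n                              ≈⟨ R.+-cong (coeff-+ p q n) (coeff-+ r s n) ⟩
    (coeff p n R.+ coeff q n) R.+ (coeff r n R.+ coeff s n)          ≈⟨ interchange _ _ _ _ ⟩
    (coeff p n R.+ coeff r n) R.+ (coeff q n R.+ coeff s n)          ≈⟨ R.+-cong (coeff-+ p r n) (coeff-+ q s n) ⟨
    coeff (p + r) n R.+ coeff (q + s) n                              ≈⟨ coeff-+ (p + r) (q + s) n ⟨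
    coeff (p + r + (q + s)) n                                        ∎
    where open import Relation.Binary.Reasoning.Setoid R.setoid

  ·-cong : ∀ {a b p q} → a R.≈ b → p ≈ q → a · p ≈ b · q
  ·-cong {a} {b} {p} {q} a≈b p≈q .coeff-≈ n =
    R.trans (coeff-· a p n) (R.trans (R.*-cong a≈b (coeff-≈ p≈q n)) (R.sym (coeff-· b q n)))

  ·-zeroˡ : ∀ p → R.0# · p ≈ []
  ·-zeroˡ p .coeff-≈ n = R.trans (coeff-· _ p n) (R.zeroˡ _)

  ·-identityˡ : ∀ p → R.1# · p ≈ p
  ·-identityˡ p .coeff-≈ n = R.trans (coeff-· _ p n) (R.*-identityˡ _)

  ·-distribˡ : ∀ a p q → a · (p + q) ≈ a · p + a · q
  ·-distribˡ a p q .coeff-≈ n = begin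
    coeff (a · (p + q)) n                           ≈⟨ coeff-· a (p + q) n ⟩
    a R.* coeff (p + q) n                           ≈⟨ R.*-congˡ (coeff-+ p q n) ⟩
    a R.* (coeff p n R.+ coeff q n)                 ≈⟨ R.distribˡ _ _ _ ⟩
    a R.* coeff p n R.+ a R.* coeff q n             ≈⟨ R.+-cong (coeff-· a p n) (coeff-· a q n) ⟨
    coeff (a · p) n R.+ coeff (a · q) n             ≈⟨ coeff-+ (a · p) (a · q) n ⟨
    coeff (a · p + a · q) n                         ∎
    where open import Relation.Binary.Reasoning.Setoid R.setoid

  ·-distribʳ : ∀ p a b → (a R.+ b) · p ≈ a · p + b · p
  ·-distribʳ p a b .coeff-≈ n = begin
    coeff ((a R.+ b) · p) n                         ≈⟨ coeff-· _ p n ⟩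
    (a R.+ b) R.* coeff p n                         ≈⟨ R.distribʳ _ _ _ ⟩
    a R.* coeff p n R.+ b R.* coeff p n             ≈⟨ R.+-cong (coeff-· a p n) (coeff-· b p n) ⟨
    coeff (a · p) n R.+ coeff (b · p) n             ≈⟨ coeff-+ (a · p) (b · p) n ⟨
    coeff (a · p + b · p) n                         ∎
    where open import Relation.Binary.Reasoning.Setoid R.setoid

  ·-assoc : ∀ a b p → (a R.* b) · p ≈ a · (b · p)
  ·-assoc a b p .coeff-≈ n = begin
    coeff ((a R.* b) · p) n         ≈⟨ coeff-· _ p n ⟩
    a R.* b R.* coeff p n           ≈⟨ R.*-assoc _ _ _ ⟩
    a R.* (b R.* coeff p n)         ≈⟨ R.*-congˡ (coeff-· b p n) ⟨
    a R.* coeff (b · p) n           ≈⟨ coeff-· a (b · p) n ⟨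
    coeff (a · (b · p)) n           ∎
    where open import Relation.Binary.Reasoning.Setoid R.setoid

  0∷-+ : ∀ p q → R.0# ∷ (p + q) ≈ (R.0# ∷ p) + (R.0# ∷ q)
  0∷-+ p q = ∷-cong (R.sym (R.+-identityˡ _)) ≈-refl

  -- Lists of zeros of any length represent 0, so congruence in the left factor has to compare lists
  -- of different lengths; this serves when one of them runs out.
  ≈[]⇒*≈[] : ∀ {p} → p ≈ [] → ∀ q → p * q ≈ []
  ≈[]⇒*≈[] {[]}    e q = ≈-refl
  ≈[]⇒*≈[] {a ∷ p} e q =
    ≈-trans (+-cong (≈-trans (·-cong (coeff-≈ e 0) ≈-refl) (·-zeroˡ q))
                    (≈-trans (∷-cong R.refl (≈[]⇒*≈[] (∷≈[]⇒tail≈[] e) q)) 0∷[]≈[]))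
            ≈-refl

  *-congʳ : ∀ {p p′} q → p ≈ p′ → p * q ≈ p′ * q
  *-congʳ {[]}    {p′}     q e = ≈-sym (≈[]⇒*≈[] (≈-sym e) q)
  *-congʳ {a ∷ p} {[]}     q e = ≈[]⇒*≈[] e q
  *-congʳ {a ∷ p} {b ∷ p′} q e =
    +-cong (·-cong (coeff-≈ e 0) ≈-refl) (∷-cong R.refl (*-congʳ q (tail-≈ e)))

  *-congˡ : ∀ p {q q′} → q ≈ q′ → p * q ≈ p * q′
  *-congˡ []      e = ≈-refl
  *-congˡ (a ∷ p) e = +-cong (·-cong R.refl e) (∷-cong R.refl (*-congˡ p e))

  *-cong : ∀ {p p′ q q′} → p ≈ p′ → q ≈ q′ → p * q ≈ p′ * q′
  *-cong {p} {p′} {q} e f = ≈-trans (*-congʳ q e) (*-congˡ p′ f)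

  *-distribʳ-+ : ∀ r p q → (p + q) * r ≈ p * r + q * r
  *-distribʳ-+ r []      q       = ≈-refl
  *-distribʳ-+ r (a ∷ p) []      = ≈-sym (+-identityʳ _)
  *-distribʳ-+ r (a ∷ p) (b ∷ q) =
    ≈-trans (+-cong (·-distribʳ r a b) (≈-trans (∷-cong R.refl (*-distribʳ-+ r p q)) (0∷-+ (p * r) (q * r))))
            (+-interchange (a · r) (b · r) (R.0# ∷ p * r) (R.0# ∷ q * r))

  *-distribˡ-+ : ∀ p q r → p * (q + r) ≈ p * q + p * r
  *-distribˡ-+ []      q r = ≈-refl
  *-distribˡ-+ (a ∷ p) q r =
    ≈-trans (+-cong (·-distribˡ a q r) (≈-trans (∷-cong R.refl (*-distribˡ-+ p q r)) (0∷-+ (p * q) (p * r))))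
            (+-interchange (a · q) (a · r) (R.0# ∷ p * q) (R.0# ∷ p * r))

  *-zeroʳ : ∀ p → p * [] ≈ []
  *-zeroʳ []      = ≈-refl
  *-zeroʳ (a ∷ p) = ≈-trans (∷-cong R.refl (*-zeroʳ p)) 0∷[]≈[]

  -- The mirror image of the defining equation of `_*_`, which recurses on its left factor;
  -- commutativity follows from the pair by induction.
  *-∷ : ∀ p b q → p * (b ∷ q) ≈ b · p + (R.0# ∷ p * q)
  *-∷ []      b q = ≈-sym 0∷[]≈[]
  *-∷ (a ∷ p) b q =
    ∷-cong (R.+-congʳ (R.*-comm a b))
           (≈-trans (+-cong ≈-refl (*-∷ p b q))
           (≈-trans (≈-sym (+-assoc (a · q) (b · p) _))
           (≈-trans (+-cong (+-comm (a · q) (b · p)) ≈-refl) (+-assoc (b · p) (a · q) _))))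

  *-comm : ∀ p q → p * q ≈ q * p
  *-comm p []      = *-zeroʳ p
  *-comm p (b ∷ q) = ≈-trans (*-∷ p b q) (+-cong ≈-refl (∷-cong R.refl (*-comm p q)))

  ·-* : ∀ a p q → (a · p) * q ≈ a · (p * q)
  ·-* a []      q = ≈-refl
  ·-* a (b ∷ p) q =
    ≈-trans (+-cong (·-assoc a b q) (∷-cong (R.sym (R.zeroʳ a)) (·-* a p q)))
            (≈-sym (·-distribˡ a (b · q) (R.0# ∷ p * q)))

  0∷-* : ∀ p q → (R.0# ∷ p) * q ≈ R.0# ∷ p * q
  0∷-* p q = +-cong (·-zeroˡ q) ≈-refl

  *-assoc : ∀ p q r → (p * q) * r ≈ p * (q * r)
  *-assoc []      q r = ≈-refl
  *-assoc (a ∷ p) q r =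
    ≈-trans (*-distribʳ-+ r (a · q) (R.0# ∷ p * q))
            (+-cong (·-* a q r) (≈-trans (0∷-* (p * q) r) (∷-cong R.refl (*-assoc p q r))))

  C-* : ∀ a p → C a * p ≈ a · p
  C-* a p = ≈-trans (+-cong ≈-refl 0∷[]≈[]) (+-identityʳ _)

  *-identityˡ : ∀ p → C R.1# * p ≈ p
  *-identityˡ p = ≈-trans (C-* R.1# p) (·-identityˡ p)

  commutativeRing : CommutativeRing 0ℓ 0ℓ
  commutativeRing = record
    { _≈_ = _≈_
    ; _+_ = _+_
    ; _*_ = _*_
    ; -_  = -_
    ; 0#  = []
    ; 1#  = C R.1#
    ; isCommutativeRing = record
      { isRing = record
        { +-isAbelianGroup = record
          { isGroup = record
            { isMonoid = record
              { isSemigroup = record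
                { isMagma = record
                  { isEquivalence = record { refl = ≈-refl ; sym = ≈-sym ; trans = ≈-trans }
                  ; ∙-cong = +-cong
                  }
                ; assoc = +-assoc
                }
              ; identity = (λ p → ≈-refl) , +-identityʳ
              }
            ; inverse = (λ p → ≈-trans (+-comm (- p) p) (-‿inverseʳ p)) , -‿inverseʳ
            ; ⁻¹-cong = -‿cong
            }
          ; comm = +-comm
          }
        ; *-cong = *-cong
        ; *-assoc = *-assoc
        ; *-identity = *-identityˡ , λ p → ≈-trans (*-comm p _) (*-identityˡ p)
        ; distrib = *-distribˡ-+ , *-distribʳ-+
        }
      ; *-comm = *-comm
      }
    }
    where open import Data.Product.Base using (_,_)

-- Ring homomorphisms, evaluation and change of coefficients.

module RingHomomorphism (R S : CommutativeRing 0ℓ 0ℓ) where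
  private
    module R = CommutativeRing R
    module S = CommutativeRing S
  open RingMorphisms R.rawRing S.rawRing public using (IsRingHomomorphism; module IsRingHomomorphism)

  isRingHomomorphism : (f : R.Carrier → S.Carrier) →
    (∀ {x y} → x R.≈ y → f x S.≈ f y) →
    (∀ x y → f (x R.+ y) S.≈ f x S.+ f y) →
    (∀ x y → f (x R.* y) S.≈ f x S.* f y) →
    f R.1# S.≈ S.1# →
    IsRingHomomorphism f
  isRingHomomorphism f cong +-homo *-homo 1-homo = record
    { isSemiringHomomorphism = record
      { isNearSemiringHomomorphism = record
        { +-isMonoidHomomorphism = record
          { isMagmaHomomorphism = record
            { isRelHomomorphism = record { cong = cong }
            ; homo = +-homo
            }
          ; ε-homo = 0-homo
          }
        ; *-homo = *-homo
        }
      ; 1#-homo = 1-homo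
      }
    ; -‿homo = λ x → AbelianGroupProperties.inverseʳ-unique S.+-abelianGroup (f x) (f (R.- x))
        (S.trans (S.sym (+-homo x (R.- x))) (S.trans (cong (R.-‿inverseʳ x)) 0-homo))
    }
    where
    0-homo : f R.0# S.≈ S.0#
    0-homo = RingProperties.x+x≈x⇒x≈0 S.ring _
      (S.trans (S.sym (+-homo R.0# R.0#)) (cong (R.+-identityʳ R.0#)))

module Evaluation (R S : CommutativeRing 0ℓ 0ℓ)
  (ι : CommutativeRing.Carrier R → CommutativeRing.Carrier S)
  (ι-homo : RingHomomorphism.IsRingHomomorphism R S ι)
  (s : CommutativeRing.Carrier S) where
  private
    module R = CommutativeRing R
  open CommutativeRing S
  open RingHomomorphism.IsRingHomomorphism R S ι-homo
  open IntegerCoefficientSolver S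
  open SetoidReasoning setoid
  private
    module P = PolynomialRing R

  eval : P.Poly → Carrier
  eval []      = 0#
  eval (a ∷ p) = ι a + s * eval p

  eval-≈[] : ∀ {p} → p P.≈ [] → eval p ≈ 0#
  eval-≈[] {[]}    e = refl
  eval-≈[] {a ∷ p} e = begin
    ι a + s * eval p  ≈⟨ +-cong (trans (⟦⟧-cong (P.coeff-≈ e 0)) 0#-homo) (*-congˡ (eval-≈[] (P.∷≈[]⇒tail≈[] e))) ⟩
    0# + s * 0#       ≈⟨ solve 1 (λ s → con 0ℤ :+ s :* con 0ℤ := con 0ℤ) refl s ⟩
    0#                ∎

  eval-cong : ∀ {p q} → p P.≈ q → eval p ≈ eval q
  eval-cong {[]}    {q}     e = sym (eval-≈[] (P.≈-sym e))
  eval-cong {a ∷ p} {[]}    e = eval-≈[] e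
  eval-cong {a ∷ p} {b ∷ q} e = +-cong (⟦⟧-cong (P.coeff-≈ e 0)) (*-congˡ (eval-cong (P.tail-≈ e)))

  eval-+ : ∀ p q → eval (p P.+ q) ≈ eval p + eval q
  eval-+ []      q       = sym (+-identityˡ _)
  eval-+ (a ∷ p) []      = sym (+-identityʳ _)
  eval-+ (a ∷ p) (b ∷ q) = begin
    ι (a R.+ b) + s * eval (p P.+ q)              ≈⟨ +-cong (+-homo a b) (*-congˡ (eval-+ p q)) ⟩
    ι a + ι b + s * (eval p + eval q)
      ≈⟨ solve 5 (λ a b s p q → a :+ b :+ s :* (p :+ q) := a :+ s :* p :+ (b :+ s :* q)) refl (ι a) (ι b) s (eval p) (eval q) ⟩
    ι a + s * eval p + (ι b + s * eval q)         ∎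

  eval-· : ∀ a p → eval (a P.· p) ≈ ι a * eval p
  eval-· a []      = sym (zeroʳ _)
  eval-· a (b ∷ p) = begin
    ι (a R.* b) + s * eval (a P.· p)     ≈⟨ +-cong (*-homo a b) (*-congˡ (eval-· a p)) ⟩
    ι a * ι b + s * (ι a * eval p)
      ≈⟨ solve 4 (λ a b s p → a :* b :+ s :* (a :* p) := a :* (b :+ s :* p)) refl (ι a) (ι b) s (eval p) ⟩
    ι a * (ι b + s * eval p)             ∎

  eval-* : ∀ p q → eval (p P.* q) ≈ eval p * eval q
  eval-* []      q = sym (zeroˡ _)
  eval-* (a ∷ p) q = begin
    eval (a P.· q P.+ (R.0# ∷ p P.* q))           ≈⟨ eval-+ (a P.· q) _ ⟩
    eval (a P.· q) + (ι R.0# + s * eval (p P.* q)) ≈⟨ +-cong (eval-· a q) (+-cong 0#-homo (*-congˡ (eval-* p q))) ⟩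
    ι a * eval q + (0# + s * (eval p * eval q))
      ≈⟨ solve 4 (λ a s p q → a :* q :+ (con 0ℤ :+ s :* (p :* q)) := (a :+ s :* p) :* q) refl (ι a) s (eval p) (eval q) ⟩
    (ι a + s * eval p) * eval q                   ∎

  eval-C : ∀ a → eval (P.C a) ≈ ι a
  eval-C a = trans (+-congˡ (zeroʳ s)) (+-identityʳ _)

  eval-X : eval P.X ≈ s
  eval-X = begin
    ι R.0# + s * eval (P.C R.1#)   ≈⟨ +-cong 0#-homo (*-congˡ (trans (eval-C R.1#) 1#-homo)) ⟩
    0# + s * 1#                    ≈⟨ solve 1 (λ s → con 0ℤ :+ s :* con 1ℤ := s) refl s ⟩
    s                              ∎

  eval-isRingHomomorphism : RingHomomorphism.IsRingHomomorphism P.commutativeRing S eval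
  eval-isRingHomomorphism = RingHomomorphism.isRingHomomorphism P.commutativeRing S
    eval eval-cong eval-+ eval-* (trans (eval-C R.1#) 1#-homo)

module CoefficientMap (R S : CommutativeRing 0ℓ 0ℓ)
  (ι : CommutativeRing.Carrier R → CommutativeRing.Carrier S)
  (ι-homo : RingHomomorphism.IsRingHomomorphism R S ι) where
  private
    module R = CommutativeRing R
    module S = CommutativeRing S
    module P = PolynomialRing R
    module Q = PolynomialRing S
  open RingHomomorphism.IsRingHomomorphism R S ι-homo

  coeff-map : ∀ p n → Q.coeff (map ι p) n S.≈ ι (P.coeff p n)
  coeff-map []      n       = S.sym 0#-homo
  coeff-map (a ∷ p) zero    = S.refl
  coeff-map (a ∷ p) (suc n) = coeff-map p n

  map-cong : ∀ {p q} → p P.≈ q → map ι p Q.≈ map ι q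
  map-cong {p} {q} e .Q.coeff-≈ n =
    S.trans (coeff-map p n) (S.trans (⟦⟧-cong (P.coeff-≈ e n)) (S.sym (coeff-map q n)))

  map-+ : ∀ p q → map ι (p P.+ q) Q.≈ map ι p Q.+ map ι q
  map-+ []      q       = Q.≈-refl
  map-+ (a ∷ p) []      = Q.≈-refl
  map-+ (a ∷ p) (b ∷ q) = Q.∷-cong (+-homo a b) (map-+ p q)

  map-· : ∀ a p → map ι (a P.· p) Q.≈ ι a Q.· map ι p
  map-· a []      = Q.≈-refl
  map-· a (b ∷ p) = Q.∷-cong (*-homo a b) (map-· a p)

  map-* : ∀ p q → map ι (p P.* q) Q.≈ map ι p Q.* map ι q
  map-* []      q = Q.≈-refl
  map-* (a ∷ p) q =
    Q.≈-trans (map-+ (a P.· q) _) (Q.+-cong (map-· a q) (Q.∷-cong 0#-homo (map-* p q)))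

  map-isRingHomomorphism : RingHomomorphism.IsRingHomomorphism P.commutativeRing Q.commutativeRing (map ι)
  map-isRingHomomorphism = RingHomomorphism.isRingHomomorphism P.commutativeRing Q.commutativeRing
    (map ι) map-cong map-+ map-* (Q.∷-cong 1#-homo Q.≈-refl)

module Constants (R : CommutativeRing 0ℓ 0ℓ) where
  private module R = CommutativeRing R
  open PolynomialRing R

  C-cong : ∀ {a b} → a R.≈ b → C a ≈ C b
  C-cong a≈b = ∷-cong a≈b ≈-refl

  C-isRingHomomorphism : RingHomomorphism.IsRingHomomorphism R commutativeRing C
  C-isRingHomomorphism = RingHomomorphism.isRingHomomorphism R commutativeRing
    C C-cong (λ a b → ≈-refl) (λ a b → ≈-sym (C-* a (C b))) ≈-refl

-- Adjoining a square root: norm, conjugation and universal property.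

module QuadraticExtension (K : CommutativeRing 0ℓ 0ℓ) (s : CommutativeRing.Carrier K) where
  private module K = CommutativeRing K
  open IntegerCoefficientSolver K

  Carrier : Set
  Carrier = K.Carrier × K.Carrier

  infix  4 _≈_
  infixl 6 _+_
  infixl 7 _*_
  infix  8 -_

  _≈_ : Carrier → Carrier → Set
  (a , b) ≈ (c , d) = (a K.≈ c) × (b K.≈ d)

  _+_ _*_ : Carrier → Carrier → Carrier
  (a , b) + (c , d) = a K.+ c , b K.+ d
  (a , b) * (c , d) = a K.* c K.+ s K.* (b K.* d) , a K.* d K.+ b K.* c

  -_ : Carrier → Carrier
  - (a , b) = K.- a , K.- b

  embed : K.Carrier → Carrier
  embed a = a , K.0#

  √s : Carrier
  √s = K.0# , K.1#

  norm : Carrier → K.Carrier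
  norm (a , b) = a K.* a K.- s K.* (b K.* b)

  conjugate : Carrier → Carrier
  conjugate (a , b) = a , K.- b

  *-comm : ∀ x y → x * y ≈ y * x
  *-comm (a , b) (c , d) =
    solve 5 (λ s a b c d → a :* c :+ s :* (b :* d) := c :* a :+ s :* (d :* b)) K.refl s a b c d ,
    solve 4 (λ a b c d → a :* d :+ b :* c := c :* b :+ d :* a) K.refl a b c d

  *-assoc : ∀ x y z → (x * y) * z ≈ x * (y * z)
  *-assoc (a , b) (c , d) (e , f) =
    solve 7 (λ s a b c d e f → (a :* c :+ s :* (b :* d)) :* e :+ s :* ((a :* d :+ b :* c) :* f)
                            := a :* (c :* e :+ s :* (d :* f)) :+ s :* (b :* (c :* f :+ d :* e)))
      K.refl s a b c d e f ,
    solve 7 (λ s a b c d e f → (a :* c :+ s :* (b :* d)) :* f :+ (a :* d :+ b :* c) :* e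
                            := a :* (c :* f :+ d :* e) :+ b :* (c :* e :+ s :* (d :* f)))
      K.refl s a b c d e f

  *-identityˡ : ∀ x → embed K.1# * x ≈ x
  *-identityˡ (a , b) =
    solve 3 (λ s a b → con 1ℤ :* a :+ s :* (con 0ℤ :* b) := a) K.refl s a b ,
    solve 2 (λ a b → con 1ℤ :* b :+ con 0ℤ :* a := b) K.refl a b

  *-distribˡ-+ : ∀ x y z → x * (y + z) ≈ x * y + x * z
  *-distribˡ-+ (a , b) (c , d) (e , f) =
    solve 7 (λ s a b c d e f → a :* (c :+ e) :+ s :* (b :* (d :+ f))
                            := a :* c :+ s :* (b :* d) :+ (a :* e :+ s :* (b :* f)))
      K.refl s a b c d e f ,
    solve 6 (λ a b c d e f → a :* (d :+ f) :+ b :* (c :+ e)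
                          := a :* d :+ b :* c :+ (a :* f :+ b :* e))
      K.refl a b c d e f

  ≈-refl : ∀ {x} → x ≈ x
  ≈-refl = K.refl , K.refl

  ≈-sym : ∀ {x y} → x ≈ y → y ≈ x
  ≈-sym (e , f) = K.sym e , K.sym f

  ≈-trans : ∀ {x y z} → x ≈ y → y ≈ z → x ≈ z
  ≈-trans (e , f) (g , h) = K.trans e g , K.trans f h

  +-cong : ∀ {x x′ y y′} → x ≈ x′ → y ≈ y′ → x + y ≈ x′ + y′
  +-cong (e , f) (g , h) = K.+-cong e g , K.+-cong f h

  *-cong : ∀ {x x′ y y′} → x ≈ x′ → y ≈ y′ → x * y ≈ x′ * y′
  *-cong (e , f) (g , h) =
    K.+-cong (K.*-cong e g) (K.*-congˡ (K.*-cong f h)) , K.+-cong (K.*-cong e h) (K.*-cong f g)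

  commutativeRing : CommutativeRing 0ℓ 0ℓ
  commutativeRing = record
    { _≈_ = _≈_
    ; _+_ = _+_
    ; _*_ = _*_
    ; -_  = -_
    ; 0#  = embed K.0#
    ; 1#  = embed K.1#
    ; isCommutativeRing = record
      { isRing = record
        { +-isAbelianGroup = record
          { isGroup = record
            { isMonoid = record
              { isSemigroup = record
                { isMagma = record
                  { isEquivalence = record { refl = ≈-refl ; sym = ≈-sym ; trans = ≈-trans }
                  ; ∙-cong = +-cong
                  }
                ; assoc = λ (a , b) (c , d) (e , f) → K.+-assoc a c e , K.+-assoc b d f
                }
              ; identity = (λ (a , b) → K.+-identityˡ a , K.+-identityˡ b)
                         , (λ (a , b) → K.+-identityʳ a , K.+-identityʳ b)
              }
            ; inverse = (λ (a , b) → K.-‿inverseˡ a , K.-‿inverseˡ b)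
                      , (λ (a , b) → K.-‿inverseʳ a , K.-‿inverseʳ b)
            ; ⁻¹-cong = λ (e , f) → K.-‿cong e , K.-‿cong f
            }
          ; comm = λ (a , b) (c , d) → K.+-comm a c , K.+-comm b d
          }
        ; *-cong = *-cong
        ; *-assoc = *-assoc
        ; *-identity = *-identityˡ , λ x → ≈-trans (*-comm x _) (*-identityˡ x)
        ; distrib = *-distribˡ-+ , λ x y z →
            ≈-trans (*-comm (y + z) x) (≈-trans (*-distribˡ-+ x y z) (+-cong (*-comm x y) (*-comm x z)))
        }
      ; *-comm = *-comm
      }
    }

  embed-isRingHomomorphism : RingHomomorphism.IsRingHomomorphism K commutativeRing embed
  embed-isRingHomomorphism = RingHomomorphism.isRingHomomorphism K commutativeRing embed
    (_, K.refl)
    (λ a b → K.refl , K.sym (K.+-identityˡ K.0#))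
    (λ a b → solve 3 (λ s a b → a :* b := a :* b :+ s :* (con 0ℤ :* con 0ℤ)) K.refl s a b
           , solve 2 (λ a b → con 0ℤ := a :* con 0ℤ :+ con 0ℤ :* b) K.refl a b)
    ≈-refl

  norm-cong : ∀ {x y} → x ≈ y → norm x K.≈ norm y
  norm-cong (e , f) = K.+-cong (K.*-cong e e) (K.-‿cong (K.*-congˡ (K.*-cong f f)))

  -- Brahmagupta's identity: the norm is the product with the conjugate, and conjugation is
  -- multiplicative.
  norm-* : ∀ x y → norm (x * y) K.≈ norm x K.* norm y
  norm-* (a , b) (c , d) =
    solve 5 (λ s a b c d →
        (a :* c :+ s :* (b :* d)) :* (a :* c :+ s :* (b :* d)) :-
        s :* ((a :* d :+ b :* c) :* (a :* d :+ b :* c))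
      := (a :* a :- s :* (b :* b)) :* (c :* c :- s :* (d :* d)))
      K.refl s a b c d

  norm-embed : ∀ a → norm (embed a) K.≈ a K.* a
  norm-embed a = solve 2 (λ s a → a :* a :- s :* (con 0ℤ :* con 0ℤ) := a :* a) K.refl s a

  norm-√s : norm √s K.≈ K.- s
  norm-√s = solve 1 (λ s → con 0ℤ :* con 0ℤ :- s :* (con 1ℤ :* con 1ℤ) := :- s) K.refl s

  √s-* : ∀ a b → √s * (a , b) ≈ (s K.* b , a)
  √s-* a b =
    solve 3 (λ s a b → con 0ℤ :* a :+ s :* (con 1ℤ :* b) := s :* b) K.refl s a b ,
    solve 2 (λ a b → con 0ℤ :* b :+ con 1ℤ :* a := a) K.refl a b

  conjugate-* : ∀ x → conjugate x * x ≈ embed (norm x)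
  conjugate-* (a , b) =
    solve 3 (λ s a b → a :* a :+ s :* (:- b :* b) := a :* a :- s :* (b :* b)) K.refl s a b ,
    solve 2 (λ a b → a :* b :+ :- b :* a := con 0ℤ) K.refl a b

module QuadraticExtensionLift (K T : CommutativeRing 0ℓ 0ℓ) (s : CommutativeRing.Carrier K)
  (ι : CommutativeRing.Carrier K → CommutativeRing.Carrier T)
  (ι-homo : RingHomomorphism.IsRingHomomorphism K T ι)
  (d : CommutativeRing.Carrier T)
  (d²≈s : CommutativeRing._≈_ T (CommutativeRing._*_ T d d) (ι s)) where
  private
    module K = CommutativeRing K
    module E = QuadraticExtension K s
  open CommutativeRing T
  open RingHomomorphism.IsRingHomomorphism K T ι-homo
  open IntegerCoefficientSolver T
  open SetoidReasoning setoid

  -- The universal property of K[t]/(t² = s): a homomorphism on K extends as soon as an image `d` of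
  -- t with the right square is chosen.
  lift : E.Carrier → Carrier
  lift (a , b) = ι a + d * ι b

  lift-embed : ∀ a → lift (E.embed a) ≈ ι a
  lift-embed a = trans (+-congˡ (trans (*-congˡ 0#-homo) (zeroʳ d))) (+-identityʳ _)

  lift-isRingHomomorphism : RingHomomorphism.IsRingHomomorphism E.commutativeRing T lift
  lift-isRingHomomorphism = RingHomomorphism.isRingHomomorphism E.commutativeRing T lift
    (λ (e , f) → +-cong (⟦⟧-cong e) (*-congˡ (⟦⟧-cong f)))
    (λ (a , b) (a′ , b′) → begin
      ι (a K.+ a′) + d * ι (b K.+ b′)               ≈⟨ +-cong (+-homo a a′) (*-congˡ (+-homo b b′)) ⟩
      ι a + ι a′ + d * (ι b + ι b′)
        ≈⟨ solve 5 (λ d a b a′ b′ → a :+ a′ :+ d :* (b :+ b′) := a :+ d :* b :+ (a′ :+ d :* b′)) refl d (ι a) (ι b) (ι a′) (ι b′) ⟩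
      ι a + d * ι b + (ι a′ + d * ι b′)             ∎)
    (λ (a , b) (a′ , b′) → begin
      ι (a K.* a′ K.+ s K.* (b K.* b′)) + d * ι (a K.* b′ K.+ b K.* a′)
        ≈⟨ +-cong (trans (+-homo _ _) (+-cong (*-homo a a′) (trans (*-homo s _) (*-cong (sym d²≈s) (*-homo b b′)))))
                  (*-congˡ (trans (+-homo _ _) (+-cong (*-homo a b′) (*-homo b a′)))) ⟩
      ι a * ι a′ + d * d * (ι b * ι b′) + d * (ι a * ι b′ + ι b * ι a′)
        ≈⟨ solve 5 (λ d a b a′ b′ → a :* a′ :+ d :* d :* (b :* b′) :+ d :* (a :* b′ :+ b :* a′)
                                  := (a :+ d :* b) :* (a′ :+ d :* b′)) refl d (ι a) (ι b) (ι a′) (ι b′) ⟩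
      (ι a + d * ι b) * (ι a′ + d * ι b′)           ∎)
    (trans (lift-embed K.1#) 1#-homo)

-- Degrees, division with remainder, and Euclid's lemma for polynomials over a field.

module Degree (R : CommutativeRing 0ℓ 0ℓ) where
  private module R = CommutativeRing R
  open PolynomialRing R
  open import Algebra.Properties.Ring R.ring using (-0#≈0#)

  -- An upper bound, degree below n, is used in place of a degree so that the zero polynomial and
  -- padded lists need no special treatment. In particular `Bounded 1` stands for constants, and
  -- `Bounded (suc m)` with a nonzero coefficient at m for degree m.
  record Bounded (n : ℕ) (p : Poly) : Set where
    constructor mkBounded
    field
      coeff-≥ : ∀ k → n ≤ k → coeff p k R.≈ R.0#

  open Bounded public

  Bounded-≈ : ∀ {n p q} → p ≈ q → Bounded n p → Bounded n q
  Bounded-≈ p≈q b .coeff-≥ k n≤k = R.trans (R.sym (coeff-≈ p≈q k)) (coeff-≥ b k n≤k)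

  Bounded-≤ : ∀ {m n p} → m ≤ n → Bounded m p → Bounded n p
  Bounded-≤ m≤n b .coeff-≥ k n≤k = coeff-≥ b k (ℕₚ.≤-trans m≤n n≤k)

  Bounded-tail : ∀ {n a p} → Bounded (suc n) (a ∷ p) → Bounded n p
  Bounded-tail b .coeff-≥ k n≤k = coeff-≥ b (suc k) (s≤s n≤k)

  Bounded-∷ : ∀ {n p} a → Bounded n p → Bounded (suc n) (a ∷ p)
  Bounded-∷ a b .coeff-≥ (suc k) (s≤s n≤k) = coeff-≥ b k n≤k

  Bounded-+ : ∀ {n p q} → Bounded n p → Bounded n q → Bounded n (p + q)
  Bounded-+ {p = p} {q} b c .coeff-≥ k n≤k =
    R.trans (coeff-+ p q k) (R.trans (R.+-cong (coeff-≥ b k n≤k) (coeff-≥ c k n≤k)) (R.+-identityʳ _))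

  Bounded-neg : ∀ {n p} → Bounded n p → Bounded n (- p)
  Bounded-neg {p = p} b .coeff-≥ k n≤k =
    R.trans (coeff-neg p k) (R.trans (R.-‿cong (coeff-≥ b k n≤k)) -0#≈0#)

  Bounded-C : ∀ a → Bounded 1 (C a)
  Bounded-C a .coeff-≥ (suc k) _ = R.refl

  Bounded-0 : ∀ {p} → Bounded 0 p → p ≈ []
  Bounded-0 b .coeff-≈ k = coeff-≥ b k z≤n

  ≈[]⇒Bounded : ∀ {n p} → p ≈ [] → Bounded n p
  ≈[]⇒Bounded e .coeff-≥ k _ = coeff-≈ e k

  Bounded-suc : ∀ {n p} → coeff p n R.≈ R.0# → Bounded (suc n) p → Bounded n p
  Bounded-suc e b .coeff-≥ k n≤k with ℕₚ.m≤n⇒m<n∨m≡n n≤k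
  ... | inj₁ n<k    = coeff-≥ b k n<k
  ... | inj₂ ≡.refl = e

  Bounded-1 : ∀ {p} → Bounded 1 p → p ≈ C (coeff p 0)
  Bounded-1 b .coeff-≈ zero    = R.refl
  Bounded-1 b .coeff-≈ (suc k) = coeff-≥ b (suc k) (s≤s z≤n)

  coeff-C* : ∀ a p k → coeff (C a * p) k R.≈ a R.* coeff p k
  coeff-C* a p k = R.trans (coeff-≈ (C-* a p) k) (coeff-· a p k)

  Bounded-C* : ∀ {n p} a → Bounded n p → Bounded n (C a * p)
  Bounded-C* {p = p} a b .coeff-≥ k n≤k =
    R.trans (coeff-C* a p k) (R.trans (R.*-congˡ (coeff-≥ b k n≤k)) (R.zeroʳ a))

  coeff-*-top : ∀ m n p q → Bounded (suc m) p → Bounded (suc n) q →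
                coeff (p * q) (m ℕ.+ n) R.≈ coeff p m R.* coeff q n
  coeff-*-top m n [] q bp bq = R.sym (R.zeroˡ _)
  coeff-*-top zero n (a ∷ p) q bp bq = begin
    coeff ((a ∷ p) * q) n    ≈⟨ coeff-≈ (*-congʳ q (Bounded-1 bp)) n ⟩
    coeff (C a * q) n        ≈⟨ coeff-C* a q n ⟩
    a R.* coeff q n          ∎
    where open SetoidReasoning R.setoid
  coeff-*-top (suc m) n (a ∷ p) q bp bq = begin
    coeff ((a ∷ p) * q) (suc (m ℕ.+ n))                                ≈⟨ coeff-+ (a · q) _ (suc (m ℕ.+ n)) ⟩
    coeff (a · q) (suc (m ℕ.+ n)) R.+ coeff (p * q) (m ℕ.+ n)
      ≈⟨ R.+-congʳ (R.trans (coeff-· a q (suc (m ℕ.+ n))) (R.*-congˡ (coeff-≥ bq _ (s≤s (ℕₚ.m≤n+m n m))))) ⟩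
    a R.* R.0# R.+ coeff (p * q) (m ℕ.+ n)                             ≈⟨ R.+-cong (R.zeroʳ a) (coeff-*-top m n p q (Bounded-tail bp) bq) ⟩
    R.0# R.+ coeff p m R.* coeff q n                                   ≈⟨ R.+-identityˡ _ ⟩
    coeff p m R.* coeff q n                                            ∎
    where open SetoidReasoning R.setoid

module DomainDegree (R : CommutativeRing 0ℓ 0ℓ)
  (≈0? : ∀ a → Dec (CommutativeRing._≈_ R a (CommutativeRing.0# R)))
  (*≈0⇒ : ∀ {a b} → CommutativeRing._≈_ R (CommutativeRing._*_ R a b) (CommutativeRing.0# R) →
          CommutativeRing._≈_ R a (CommutativeRing.0# R) ⊎ CommutativeRing._≈_ R b (CommutativeRing.0# R)) where
  private module R = CommutativeRing R
  open PolynomialRing R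
  open Degree R

  degree : ∀ p → p ≈ [] ⊎ ∃ λ m → Bounded (suc m) p × ¬ coeff p m R.≈ R.0#
  degree [] = inj₁ ≈-refl
  degree (a ∷ p) with degree p
  ... | inj₂ (m , b , ≉0) = inj₂ (suc m , Bounded-∷ a b , ≉0)
  ... | inj₁ p≈[] with ≈0? a
  ...   | yes a≈0 = inj₁ (≈-trans (∷-cong a≈0 p≈[]) 0∷[]≈[])
  ...   | no  a≉0 = inj₂ (zero , Bounded-∷ a (≈[]⇒Bounded p≈[]) , a≉0)

  -- Over a domain degrees add, and a nonzero coefficient at i forces p to have degree at least i,
  -- be it the leading one or not. The case n = 0 is the absence of zero divisors.
  Bounded-*⁻ : ∀ {i n} p q → ¬ coeff p i R.≈ R.0# → Bounded (i ℕ.+ n) (p * q) → Bounded n q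
  Bounded-*⁻ {i} {n} p q pᵢ≉0 b with degree p | degree q
  ... | inj₁ p≈[]          | _                 = contradiction (coeff-≈ p≈[] i) pᵢ≉0
  ... | inj₂ _             | inj₁ q≈[]         = ≈[]⇒Bounded q≈[]
  ... | inj₂ (m , bp , pₘ≉0) | inj₂ (j , bq , qⱼ≉0) = Bounded-≤ j<n bq
    where
    i≤m : i ≤ m
    i≤m = ℕₚ.≮⇒≥ λ m<i → pᵢ≉0 (coeff-≥ bp i m<i)

    j<n : j < n
    j<n = ℕₚ.≰⇒> λ n≤j → case *≈0⇒ (R.trans (R.sym (coeff-*-top m j p q bp bq)) (coeff-≥ b _ (ℕₚ.+-mono-≤ i≤m n≤j)))
      of λ where
        (inj₁ e) → pₘ≉0 e
        (inj₂ e) → qⱼ≉0 e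
      where open import Function.Base using (case_of_)

  linear-factors : ∀ p q → Bounded 2 (p * q) → Bounded 1 p ⊎ Bounded 1 q
  linear-factors p q b with degree p
  ... | inj₁ p≈[]              = inj₁ (≈[]⇒Bounded p≈[])
  ... | inj₂ (zero  , bp , _)  = inj₁ bp
  ... | inj₂ (suc m , _ , ≉0) = inj₂ (Bounded-*⁻ {suc m} {1} p q ≉0 (Bounded-≤ (s≤s (ℕₚ.m≤n+m 1 m)) b))

module DivisionIdentities (R : CommutativeRing 0ℓ 0ℓ) where
  open CommutativeRing R
  open IntegerCoefficientSolver R
  open SetoidReasoning setoid

  shift-quotient : ∀ q c p r → q * p + r ≈ (q + c) * p + (r - c * p)
  shift-quotient = solve 4 (λ q c p r → q :* p :+ r := (q :+ c) :* p :+ (r :- c :* p)) refl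

  -- Multiplying g = t p + r by q shows that g divides r q once it divides p q. This is the descent
  -- step of Euclid's lemma, where p is replaced by a remainder of smaller degree;
  -- `factor-remainder-*` does the same when p is divided by g.
  dividend-remainder-* : ∀ {g p q r t w} → g ≈ t * p + r → p * q ≈ g * w → r * q ≈ g * (q - t * w)
  dividend-remainder-* {g} {p} {q} {r} {t} {w} g≈tp+r pq≈gw = begin
    r * q                          ≈⟨ solve 4 (λ t p r q → r :* q := (t :* p :+ r) :* q :- t :* (p :* q)) refl t p r q ⟩
    (t * p + r) * q - t * (p * q)  ≈⟨ +-cong (*-congʳ g≈tp+r) (-‿cong (*-congˡ (sym pq≈gw))) ⟨
    g * q - t * (g * w)            ≈⟨ solve 4 (λ t w g q → g :* q :- t :* (g :* w) := g :* (q :- t :* w)) refl t w g q ⟩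
    g * (q - t * w)                ∎

  factor-remainder-* : ∀ {g p q r t w} → p ≈ t * g + r → p * q ≈ g * w → r * q ≈ g * (w - t * q)
  factor-remainder-* {g} {p} {q} {r} {t} {w} p≈tg+r pq≈gw = begin
    r * q                          ≈⟨ solve 4 (λ t g r q → r :* q := (t :* g :+ r) :* q :- t :* (g :* q)) refl t g r q ⟩
    (t * g + r) * q - t * (g * q)  ≈⟨ +-congʳ (*-congʳ p≈tg+r) ⟨
    p * q - t * (g * q)            ≈⟨ +-congʳ pq≈gw ⟩
    g * w - t * (g * q)            ≈⟨ solve 4 (λ t w g q → g :* w :- t :* (g :* q) := g :* (w :- t :* q)) refl t w g q ⟩
    g * (w - t * q)                ∎

  unit-cancel : ∀ {c p q g w} → c * p ≈ 1# → p * q ≈ g * w → q ≈ g * (c * w)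
  unit-cancel {c} {p} {q} {g} {w} cp≈1 pq≈gw = begin
    q              ≈⟨ *-identityˡ q ⟨
    1# * q         ≈⟨ *-congʳ cp≈1 ⟨
    c * p * q      ≈⟨ *-assoc c p q ⟩
    c * (p * q)    ≈⟨ *-congˡ pq≈gw ⟩
    c * (g * w)    ≈⟨ solve 3 (λ c g w → c :* (g :* w) := g :* (c :* w)) refl c g w ⟩
    g * (c * w)    ∎

  *-difference : ∀ {g p q} → g * p ≈ g * q → g * (p - q) ≈ 0#
  *-difference {g} {p} {q} gp≈gq = begin
    g * (p - q)      ≈⟨ solve 3 (λ g p q → g :* (p :- q) := g :* p :- g :* q) refl g p q ⟩
    g * p - g * q    ≈⟨ +-congʳ gp≈gq ⟩
    g * q - g * q    ≈⟨ -‿inverseʳ _ ⟩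
    0#               ∎

  difference≈0⇒≈ : ∀ {p q} → p - q ≈ 0# → p ≈ q
  difference≈0⇒≈ {p} {q} p-q≈0 = begin
    p            ≈⟨ solve 2 (λ p q → p := p :- q :+ q) refl p q ⟩
    p - q + q    ≈⟨ +-congʳ p-q≈0 ⟩
    0# + q       ≈⟨ +-identityˡ q ⟩
    q            ∎

  *-cofactor : ∀ {g p q r h} → p * q ≈ h → p ≈ g * r → g * (r * q) ≈ h
  *-cofactor {g} {p} {q} {r} pq≈h p≈gr = trans (sym (*-assoc g r q)) (trans (*-congʳ (sym p≈gr)) pq≈h)

  exact-division : ∀ {g t p r} → g ≈ t * p + r → r ≈ 0# → g ≈ t * p
  exact-division g≈tp+r r≈0 = trans g≈tp+r (trans (+-congˡ r≈0) (+-identityʳ _))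

module EuclidsLemma (F : CommutativeRing 0ℓ 0ℓ)
  (≈0? : ∀ a → Dec (CommutativeRing._≈_ F a (CommutativeRing.0# F)))
  (inverse : ∀ a → ¬ CommutativeRing._≈_ F a (CommutativeRing.0# F) →
             ∃ λ b → CommutativeRing._≈_ F (CommutativeRing._*_ F b a) (CommutativeRing.1# F)) where
  private module F = CommutativeRing F

  *≈0⇒ : ∀ {a b} → a F.* b F.≈ F.0# → a F.≈ F.0# ⊎ b F.≈ F.0#
  *≈0⇒ {a} {b} ab≈0 with ≈0? a
  ... | yes a≈0 = inj₁ a≈0
  ... | no  a≉0 = let (a⁻¹ , a⁻¹a≈1) = inverse a a≉0 in inj₂ (begin
    b                  ≈⟨ F.*-identityˡ b ⟨
    F.1# F.* b         ≈⟨ F.*-congʳ a⁻¹a≈1 ⟨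
    a⁻¹ F.* a F.* b    ≈⟨ F.*-assoc _ _ _ ⟩
    a⁻¹ F.* (a F.* b)  ≈⟨ F.*-congˡ ab≈0 ⟩
    a⁻¹ F.* F.0#       ≈⟨ F.zeroʳ _ ⟩
    F.0#               ∎)
    where open SetoidReasoning F.setoid

  open PolynomialRing F
  open Degree F
  open DomainDegree F ≈0? *≈0⇒ public
  open DivisionIdentities commutativeRing
  private module P = CommutativeRing commutativeRing
  open SetoidReasoning P.setoid

  private
    infix 4 _∣_
    _∣_ : Poly → Poly → Set
    p ∣ q = ∃ λ r → q ≈ p * r

  divide : ∀ n p → Bounded (suc n) p → ¬ coeff p n F.≈ F.0# →
           ∀ f → ∃ λ q → ∃ λ r → f ≈ q * p + r × Bounded n r
  divide n p b pₙ≉0 [] = [] , [] , ≈-refl , ≈[]⇒Bounded ≈-refl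
  divide n p b pₙ≉0 (a ∷ f) with divide n p b pₙ≉0 f | inverse (coeff p n) pₙ≉0
  ... | q , r , f≈ , br | pₙ⁻¹ , inv = (F.0# ∷ q) + C c , (a ∷ r) + - (C c * p) , eq , bounded
    where
    -- A quotient and remainder for f give x q and a + x r for a + x f. The latter may reach degree
    -- n, and subtracting c p removes its coefficient there.
    c = coeff (a ∷ r) n F.* pₙ⁻¹

    eq : a ∷ f ≈ ((F.0# ∷ q) + C c) * p + ((a ∷ r) + - (C c * p))
    eq = begin
      a ∷ f                                       ≈⟨ ∷-cong (F.sym (F.+-identityˡ a)) f≈ ⟩
      (F.0# ∷ q * p) + (a ∷ r)                    ≈⟨ +-congʳ (a ∷ r) (0∷-* q p) ⟨
      (F.0# ∷ q) * p + (a ∷ r)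
        ≈⟨ shift-quotient (F.0# ∷ q) (C c) p (a ∷ r) ⟩
      ((F.0# ∷ q) + C c) * p + ((a ∷ r) + - (C c * p)) ∎

    leading : coeff ((a ∷ r) + - (C c * p)) n F.≈ F.0#
    leading = F.trans (coeff-+ (a ∷ r) (- (C c * p)) n) (F.trans (F.+-congˡ (F.trans (coeff-neg (C c * p) n) (F.-‿cong
      (F.trans (coeff-C* c p n) (F.trans (F.*-assoc _ _ _) (F.trans (F.*-congˡ inv) (F.*-identityʳ _))))))) (F.-‿inverseʳ _))

    bounded : Bounded n ((a ∷ r) + - (C c * p))
    bounded = Bounded-suc leading
      (Bounded-+ {p = a ∷ r} (Bounded-∷ a br) (Bounded-neg {p = C c * p} (Bounded-C* {p = p} c b)))

  -- Phrased by degrees and not by units, since a constant factor is what Eisenstein's criterion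
  -- yields over ℤ and what survives clearing denominators.
  Irreducible : Poly → Set
  Irreducible g = ∀ p q → g ≈ p * q → Bounded 1 p ⊎ Bounded 1 q

  module _ (m : ℕ) (g : Poly) (b : Bounded (suc m) g) (gₘ≉0 : ¬ coeff g m F.≈ F.0#) (irr : Irreducible g) where

    private
      constant-∣ : ∀ {p q} → Bounded 1 p → g ∣ p * q → p ≈ [] ⊎ g ∣ q
      constant-∣ {p} {q} bp (w , pq≈gw) with ≈0? (coeff p 0)
      ... | yes p₀≈0 = inj₁ (Bounded-0 (Bounded-suc p₀≈0 bp))
      ... | no  p₀≉0 = let (c , cp₀≈1) = inverse (coeff p 0) p₀≉0 in
        inj₂ (C c * w , unit-cancel {C c} {p} {q} {g} {w}
          (≈-trans (*-congˡ (C c) (Bounded-1 bp)) (≈-trans (C-* c _) (∷-cong cp₀≈1 ≈-refl))) pq≈gw)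

      -- Needed when the remainder in the descent is 0, so that g = t p: as g has degree m and p a
      -- smaller one, t cannot be the constant factor, hence p is.
      not-constant-multiple : ∀ {t p} → Bounded m p → Bounded 1 t → ¬ g ≈ t * p
      not-constant-multiple {t} {p} bp bt g≈tp = gₘ≉0 (F.trans
        (coeff-≈ (≈-trans g≈tp (*-congʳ p (Bounded-1 bt))) m)
        (coeff-≥ (Bounded-C* (coeff t 0) bp) m ℕₚ.≤-refl))

    -- If p ≉ 0 has smaller degree than g, the remainder r of g modulo p
    -- satisfies g ∣ r q again and has smaller degree than p.
    euclid-small : ∀ n → n ≤ m → ∀ p q → Bounded n p → g ∣ p * q → p ≈ [] ⊎ g ∣ q
    euclid-small zero n≤m p q bp _ = inj₁ (Bounded-0 bp)
    euclid-small (suc n) n<m p q bp g∣pq with ≈0? (coeff p n)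
    ... | yes pₙ≈0 = euclid-small n (ℕₚ.<⇒≤ n<m) p q (Bounded-suc pₙ≈0 bp) g∣pq
    ... | no  pₙ≉0 = reduce (divide n p bp pₙ≉0 g)
      where
      finish : ∀ t → g ≈ t * p → p ≈ [] ⊎ g ∣ q
      finish t g≈tp =
        [ (λ bt → contradiction g≈tp (not-constant-multiple (Bounded-≤ n<m bp) bt))
        , (λ bp₁ → constant-∣ bp₁ g∣pq)
        ]′ (irr t p g≈tp)

      reduce : (∃ λ t → ∃ λ r → g ≈ t * p + r × Bounded n r) → p ≈ [] ⊎ g ∣ q
      reduce (t , r , g≈tp+r , br)
        = [ (λ r≈[] → finish t (exact-division {g} {t} {p} {r} g≈tp+r r≈[])) , inj₂ ]′
          (euclid-small n (ℕₚ.<⇒≤ n<m) r q br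
            (q + - (t * proj₁ g∣pq) , dividend-remainder-* {g} {p} {q} {r} {t} {proj₁ g∣pq} g≈tp+r (proj₂ g∣pq)))

    -- Reducing p modulo g brings it into the range of `euclid-small`; a vanishing remainder means
    -- that g divides p.
    euclid : ∀ p q → g ∣ p * q → g ∣ p ⊎ g ∣ q
    euclid p q (w , pq≈gw) with divide m g b gₘ≉0 p
    ... | t , r , p≈tg+r , br =
      [ (λ r≈[] → inj₁ (t , ≈-trans (exact-division {p} {t} {g} {r} p≈tg+r r≈[]) (*-comm t g))) , inj₂ ]′
      (euclid-small m ℕₚ.≤-refl r q br
        (w + - (t * q) , factor-remainder-* {g} {p} {q} {r} {t} {w} p≈tg+r pq≈gw))

    *-cancelˡ : ∀ p q → g * p ≈ g * q → p ≈ q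
    *-cancelˡ p q gp≈gq = difference≈0⇒≈ {p} {q}
      (Bounded-0 (Bounded-*⁻ {m} {0} g (p + - q) gₘ≉0 (≈[]⇒Bounded (*-difference {g} {p} {q} gp≈gq))))

    private
      cofactor : ∀ p q → p * q ≈ g * g → g ∣ p → Bounded 1 q ⊎ ∃ λ c → p ≈ C c * g
      cofactor p q pq≈gg (r , p≈gr) =
        [ (λ br → inj₂ (coeff r 0 , ≈-trans p≈gr (≈-trans (*-comm g r) (*-congʳ g (Bounded-1 br))))) , inj₁ ]′
        (irr r q (≈-sym (*-cancelˡ (r * q) g (*-cofactor {g} {p} {q} {r} {g * g} pq≈gg p≈gr))))

    -- By Euclid's lemma g divides one factor, say p = g r. Cancelling g leaves r q = g, and
    -- irreducibility makes q or r constant.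
    square-factors : ∀ p q → p * q ≈ g * g →
      (Bounded 1 q ⊎ ∃ λ c → p ≈ C c * g) ⊎ (Bounded 1 p ⊎ ∃ λ c → q ≈ C c * g)
    square-factors p q pq≈gg =
      Sum.map (cofactor p q pq≈gg) (cofactor q p (≈-trans (*-comm q p) pq≈gg)) (euclid p q (g , pq≈gg))

-- Integer polynomials: Gauss's lemma and Eisenstein's criterion.

module IntegerPolynomials where
  open import Data.Integer.Divisibility.Signed
  open PolynomialRing ℤₚ.+-*-commutativeRing public
  open Degree ℤₚ.+-*-commutativeRing public
  open DomainDegree ℤₚ.+-*-commutativeRing (ℤₚ._≟ 0ℤ) (ℤₚ.i*j≡0⇒i≡0∨j≡0 _) public

  record AllDivisible (d : ℤ) (p : Poly) : Set where
    constructor mkAllDivisible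
    field
      coeff-∣ : ∀ k → d ∣ coeff p k

  open AllDivisible public

  AllDivisible-≈ : ∀ {d p q} → p ≈ q → AllDivisible d p → AllDivisible d q
  AllDivisible-≈ {d} p≈q D .coeff-∣ k = ≡.subst (d ∣_) (coeff-≈ p≈q k) (coeff-∣ D k)

  AllDivisible-C* : ∀ d p → AllDivisible d (C d * p)
  AllDivisible-C* d p .coeff-∣ k = ≡.subst (d ∣_) (≡.sym (coeff-C* d p k)) (∣m⇒∣m*n (coeff p k) ∣-refl)

  quotient-C* : ∀ {d} p → AllDivisible d p → ∃ λ q → p ≈ C d * q
  quotient-C* []      D = [] , ≈-sym 0∷[]≈[]
  quotient-C* {d} (a ∷ p) D =
    let (q , p≈dq) = quotient-C* p (mkAllDivisible λ k → coeff-∣ D (suc k))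
    in quotient (coeff-∣ D 0) ∷ q , ≈-trans
         (∷-cong (≡.trans (_∣_.equality (coeff-∣ D 0)) (ℤₚ.*-comm _ d)) (≈-trans p≈dq (C-* d q)))
         (≈-sym (C-* d _))

  C*-cancel : ∀ {d p q} → d ≢ 0ℤ → C d * p ≈ C d * q → p ≈ q
  C*-cancel {d} {p} {q} d≢0 e .coeff-≈ k = ℤₚ.*-cancelˡ-≡ d _ _ ⦃ ℤ.≢-nonZero d≢0 ⦄
    (≡.trans (≡.sym (coeff-C* d p k)) (≡.trans (coeff-≈ e k) (coeff-C* d q k)))

  first-indivisible : ∀ d p → AllDivisible d p ⊎ ∃ λ i → (∀ k → k < i → d ∣ coeff p k) × ¬ d ∣ coeff p i
  first-indivisible d [] = inj₁ (mkAllDivisible λ k → divides 0ℤ ≡.refl)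
  first-indivisible d (a ∷ p) with d ∣? a | first-indivisible d p
  ... | no ∤a  | _                  = inj₂ (0 , (λ _ ()) , ∤a)
  ... | yes ∣a | inj₁ D             = inj₁ (mkAllDivisible λ where
    zero    → ∣a
    (suc k) → coeff-∣ D k)
  ... | yes ∣a | inj₂ (i , ∣< , ∤i) = inj₂ (suc i , (λ where
    zero    _         → ∣a
    (suc k) (s≤s k<i) → ∣< k k<i) , ∤i)

  coeff-*-∣ : ∀ {d} n p q → (∀ l → l ≤ n → d ∣ coeff q l) → d ∣ coeff (p * q) n
  coeff-*-∣ n [] q ∣q = divides 0ℤ ≡.refl
  coeff-*-∣ {d} n (a ∷ p) q ∣q = ≡.subst (d ∣_) (≡.sym (coeff-+ (a · q) _ n))
    (∣m∣n⇒∣m+n (≡.subst (d ∣_) (≡.sym (coeff-· a q n)) (∣n⇒∣m*n a (∣q n ℕₚ.≤-refl))) (tail n ∣q))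
    where
    tail : ∀ n → (∀ l → l ≤ n → d ∣ coeff q l) → d ∣ coeff (0ℤ ∷ p * q) n
    tail zero    ∣q = divides 0ℤ ≡.refl
    tail (suc n) ∣q = coeff-*-∣ n p q (λ l l≤n → ∣q l (ℕₚ.m≤n⇒m≤1+n l≤n))

  -- In the convolution sum at i + j every term but the one at (i, j) has its left index below i or
  -- its right index below j, so it is a multiple of d.
  coeff-*-low : ∀ {d} i j p q → (∀ k → k < i → d ∣ coeff p k) → (∀ l → l < j → d ∣ coeff q l) →
                ∃ λ r → coeff (p * q) (i ℕ.+ j) ≡ coeff p i ℤ.* coeff q j ℤ.+ r × d ∣ r
  coeff-*-low i j [] q ∣p ∣q = 0ℤ , ≡.refl , divides 0ℤ ≡.refl
  coeff-*-low {d} zero j (a ∷ p) q ∣p ∣q =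
    _ , ≡.trans (coeff-+ (a · q) _ j) (≡.cong (ℤ._+ coeff (0ℤ ∷ p * q) j) (coeff-· a q j)) , tail j ∣q
    where
    tail : ∀ j → (∀ l → l < j → d ∣ coeff q l) → d ∣ coeff (0ℤ ∷ p * q) j
    tail zero    ∣q = divides 0ℤ ≡.refl
    tail (suc j) ∣q = coeff-*-∣ j p q (λ l l≤j → ∣q l (s≤s l≤j))
  coeff-*-low (suc i) j (a ∷ p) q ∣p ∣q
    with coeff-*-low i j p q (λ k k<i → ∣p (suc k) (s≤s k<i)) ∣q
  ... | r , eq , d∣r =
    a ℤ.* coeff q (suc (i ℕ.+ j)) ℤ.+ r ,
    (begin
      coeff (a · q + (0ℤ ∷ p * q)) (suc (i ℕ.+ j))                    ≡⟨ coeff-+ (a · q) _ (suc (i ℕ.+ j)) ⟩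
      coeff (a · q) (suc (i ℕ.+ j)) ℤ.+ coeff (p * q) (i ℕ.+ j)        ≡⟨ ≡.cong₂ ℤ._+_ (coeff-· a q (suc (i ℕ.+ j))) eq ⟩
      a ℤ.* coeff q (suc (i ℕ.+ j)) ℤ.+ (coeff p i ℤ.* coeff q j ℤ.+ r)
        ≡⟨ x∙yz≈y∙xz (a ℤ.* coeff q (suc (i ℕ.+ j))) (coeff p i ℤ.* coeff q j) r ⟩
      coeff p i ℤ.* coeff q j ℤ.+ (a ℤ.* coeff q (suc (i ℕ.+ j)) ℤ.+ r) ∎) ,
    ∣m∣n⇒∣m+n (∣m⇒∣m*n _ (∣p 0 (s≤s z≤n))) d∣r
    where
    open ≡.≡-Reasoning
    open import Algebra.Properties.CommutativeSemigroup
      (CommutativeRing.+-commutativeSemigroup ℤₚ.+-*-commutativeRing) using (x∙yz≈y∙xz)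

  module PrimeModulus {p : ℕ} (p-prime : Prime p) where

    prime-∣* : ∀ i j → + p ∣ i ℤ.* j → + p ∣ i ⊎ + p ∣ j
    prime-∣* i j p∣ij = Sum.map ∣ᵤ⇒∣ ∣ᵤ⇒∣
      (euclidsLemma ℤ.∣ i ∣ ℤ.∣ j ∣ p-prime (≡.subst (p ℕ.∣_) (ℤₚ.abs-* i j) (∣⇒∣ᵤ p∣ij)))

    +p≢0 : + p ≢ 0ℤ
    +p≢0 p≡0 = ℕ.≢-nonZero⁻¹ p ⦃ prime⇒nonZero p-prime ⦄ (ℤₚ.+-injective p≡0)

    quotient-< : ∀ {N} q → N ≢ 0ℤ → N ≡ q ℤ.* + p → ℤ.∣ q ∣ < ℤ.∣ N ∣
    quotient-< {N} q N≢0 N≡qp = ≡.subst (ℤ.∣ q ∣ <_)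
      (≡.sym (≡.trans (≡.cong ℤ.∣_∣ N≡qp) (ℤₚ.abs-* q (+ p))))
      (ℕₚ.m<m*n ℤ.∣ q ∣ p ⦃ ℕ.≢-nonZero (q≢0 ∘ ℤₚ.∣i∣≡0⇒i≡0) ⦄ (ℕ.nonTrivial⇒n>1 p ⦃ prime⇒nonTrivial p-prime ⦄))
      where
      q≢0 : q ≢ 0ℤ
      q≢0 q≡0 = N≢0 (≡.trans N≡qp (≡.cong (ℤ._* + p) q≡0))

    -- If i and j are the first indices where u and v are indivisible, the coefficient of the
    -- product at i + j is uᵢ vⱼ modulo p, which is not 0.
    gauss : ∀ u v → AllDivisible (+ p) (u * v) → AllDivisible (+ p) u ⊎ AllDivisible (+ p) v
    gauss u v D with first-indivisible (+ p) u | first-indivisible (+ p) v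
    ... | inj₁ Du             | _                   = inj₁ Du
    ... | inj₂ _              | inj₁ Dv             = inj₂ Dv
    ... | inj₂ (i , ∣u , ∤uᵢ) | inj₂ (j , ∣v , ∤vⱼ) with coeff-*-low i j u v ∣u ∣v
    ...   | r , eq , ∣r = ⊥-elim ([ ∤uᵢ , ∤vⱼ ]′
      (prime-∣* (coeff u i) (coeff v j) (∣m+n∣n⇒∣m (≡.subst (+ p ∣_) eq (coeff-∣ D (i ℕ.+ j))) ∣r)))

    record Eisenstein (m : ℕ) (g : Poly) : Set where
      field
        bounded   : Bounded (suc m) g
        lower     : ∀ k → k < m → + p ∣ coeff g k
        leading   : ¬ + p ∣ coeff g m
        constant  : ¬ + p ℤ.* + p ∣ coeff g 0

    module _ {m : ℕ} {g : Poly} (eisenstein : Eisenstein m g) (0<m : 0 < m) where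
      open Eisenstein eisenstein

      private
        -- The heart of Eisenstein's criterion. At the first index i with p ∤ uᵢ, the coefficient of
        -- u v is uᵢ v₀ modulo p, hence nonzero; but below m all coefficients of N g vanish modulo
        -- p. So i ≥ m, u uses up the whole degree, and v is constant. Such an i exists because p
        -- does not divide N times the leading coefficient of g.
        ∤⇒bounded : ∀ N u v → ¬ + p ∣ N → C N * g ≈ u * v → ¬ + p ∣ coeff v 0 → + p ∣ coeff u 0 → Bounded 1 v
        ∤⇒bounded N u v ∤N Ng≈uv ∤v₀ ∣u₀ with first-indivisible (+ p) u
        ... | inj₁ D = ⊥-elim ([ ∤N , leading ]′ (prime-∣* N (coeff g m)
          (≡.subst (+ p ∣_) (≡.trans (≡.trans (coeff-≈ (*-comm v u) m) (≡.sym (coeff-≈ Ng≈uv m))) (coeff-C* N g m))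
            (coeff-*-∣ m v u (λ l _ → coeff-∣ D l)))))
        ... | inj₂ (i , ∣u , ∤uᵢ) = Bounded-*⁻ {i} {1} u v
          (λ uᵢ≡0 → ∤uᵢ (≡.subst (+ p ∣_) (≡.sym uᵢ≡0) (divides 0ℤ ≡.refl)))
          (Bounded-≤ m+1≤i+1 (Bounded-≈ Ng≈uv (Bounded-C* N bounded)))
          where
          m≤i : m ≤ i
          m≤i = ℕₚ.≮⇒≥ λ i<m →
            let (r , eq , ∣r) = coeff-*-low i 0 u v ∣u (λ _ ()) in
            [ ∤uᵢ , ∤v₀ ]′ (prime-∣* (coeff u i) (coeff v 0) (∣m+n∣n⇒∣m
              (≡.subst (+ p ∣_)
                (≡.trans (≡.sym (coeff-C* N g i)) (≡.trans (coeff-≈ Ng≈uv i)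
                  (≡.trans (≡.cong (coeff (u * v)) (≡.sym (ℕₚ.+-identityʳ i))) eq)))
                (∣n⇒∣m*n N (lower i i<m))) ∣r))

          m+1≤i+1 : suc m ≤ i ℕ.+ 1
          m+1≤i+1 = ≡.subst (suc m ≤_) (ℕₚ.+-comm 1 i) (s≤s m≤i)

        constant-* : ∀ N u v → C N * g ≈ u * v → N ℤ.* coeff g 0 ≡ coeff u 0 ℤ.* coeff v 0
        constant-* N u v Ng≈uv = ≡.trans (≡.sym (coeff-C* N g 0)) (≡.trans (coeff-≈ Ng≈uv 0)
          (≡.trans (proj₁ (proj₂ low)) (≡.trans (≡.cong (λ r → coeff u 0 ℤ.* coeff v 0 ℤ.+ r) (0∣⇒≡0 (proj₂ (proj₂ low)))) (ℤₚ.+-identityʳ _))))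
          where
          -- With d = 0 the remainder is a multiple of 0, so the congruence of `coeff-*-low` becomes
          -- an equation.
          low : ∃ λ r → coeff (u * v) 0 ≡ coeff u 0 ℤ.* coeff v 0 ℤ.+ r × 0ℤ ∣ r
          low = coeff-*-low 0 0 u v (λ _ ()) (λ _ ())

        both-∣ : ∀ N u v → ¬ + p ∣ N → C N * g ≈ u * v → + p ∣ coeff u 0 → + p ∣ coeff v 0 → ⊥
        both-∣ N u v ∤N Ng≈uv (divides a u₀≡) ∣v₀@(divides b v₀≡) with lower 0 0<m
        ... | divides c g₀≡ = [ ∤N , (λ ∣c → constant (≡.subst (+ p ℤ.* + p ∣_) (≡.sym g₀≡) (*-monoˡ-∣ (+ p) ∣c))) ]′
          (prime-∣* N c (divides (a ℤ.* b) (ℤₚ.*-cancelʳ-≡ _ _ (+ p) ⦃ ℤ.≢-nonZero +p≢0 ⦄ (begin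
            N ℤ.* c ℤ.* + p                    ≡⟨ ℤₚ.*-assoc N c (+ p) ⟩
            N ℤ.* (c ℤ.* + p)                  ≡⟨ ≡.cong (N ℤ.*_) g₀≡ ⟨
            N ℤ.* coeff g 0                    ≡⟨ constant-* N u v Ng≈uv ⟩
            coeff u 0 ℤ.* coeff v 0            ≡⟨ ≡.cong₂ ℤ._*_ u₀≡ v₀≡ ⟩
            (a ℤ.* + p) ℤ.* (b ℤ.* + p)        ≡⟨ ab·pp a b (+ p) ⟩
            a ℤ.* b ℤ.* + p ℤ.* + p            ∎))))
          where
          open ≡.≡-Reasoning
          open IntegerCoefficientSolver ℤₚ.+-*-commutativeRing
          ab·pp : ∀ a b c → (a ℤ.* c) ℤ.* (b ℤ.* c) ≡ a ℤ.* b ℤ.* c ℤ.* c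
          ab·pp = solve 3 (λ a b c → (a :* c) :* (b :* c) := a :* b :* c :* c) ≡.refl

      -- The scalar N is the denominator left over from a factorisation over ℚ. While p divides N,
      -- Gauss's lemma lets p be cancelled against u or v, which makes |N| smaller; once p ∤ N, the
      -- classical argument applies to the constant coefficients.
      eisenstein-irreducible : ∀ N → N ≢ 0ℤ → ∀ u v → C N * g ≈ u * v → Bounded 1 u ⊎ Bounded 1 v
      eisenstein-irreducible N = go N (<-wellFounded ℤ.∣ N ∣)
        where
        go : ∀ N → Acc _<_ ℤ.∣ N ∣ → N ≢ 0ℤ → ∀ u v → C N * g ≈ u * v → Bounded 1 u ⊎ Bounded 1 v
        go N (acc rec) N≢0 u v Ng≈uv with + p ∣? N
        ... | yes (divides q N≡qp) = [ left , right ]′ (gauss u v (AllDivisible-≈ pqg≈uv (AllDivisible-C* (+ p) (C q * g))))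
          where
          pqg≈uv : C (+ p) * (C q * g) ≈ u * v
          pqg≈uv = ≈-trans (≈-sym (*-assoc (C (+ p)) (C q) g)) (≈-trans (*-congʳ g (≈-trans (C-* (+ p) (C q))
            (∷-cong (≡.trans (ℤₚ.*-comm (+ p) q) (≡.sym N≡qp)) ≈-refl))) Ng≈uv)

          q≢0 : q ≢ 0ℤ
          q≢0 q≡0 = N≢0 (≡.trans N≡qp (≡.cong (ℤ._* + p) q≡0))

          left : AllDivisible (+ p) u → Bounded 1 u ⊎ Bounded 1 v
          left D = let (u′ , u≈pu′) = quotient-C* u D in
            Sum.map₁ (λ b → Bounded-≈ (≈-sym u≈pu′) (Bounded-C* (+ p) b))
              (go q (rec (quotient-< q N≢0 N≡qp)) q≢0 u′ v (C*-cancel +p≢0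
                (≈-trans pqg≈uv (≈-trans (*-congʳ v u≈pu′) (*-assoc (C (+ p)) u′ v)))))

          right : AllDivisible (+ p) v → Bounded 1 u ⊎ Bounded 1 v
          right D = let (v′ , v≈pv′) = quotient-C* v D in
            Sum.map₂ (λ b → Bounded-≈ (≈-sym v≈pv′) (Bounded-C* (+ p) b))
              (go q (rec (quotient-< q N≢0 N≡qp)) q≢0 u v′ (C*-cancel +p≢0
                (≈-trans pqg≈uv (≈-trans (*-congˡ u v≈pv′) (≈-trans (*-comm u (C (+ p) * v′))
                  (≈-trans (*-assoc (C (+ p)) v′ u) (*-congˡ (C (+ p)) (*-comm v′ u))))))))
        ... | no ∤N with + p ∣? coeff u 0 | + p ∣? coeff v 0
        ...   | yes ∣u₀ | yes ∣v₀ = ⊥-elim (both-∣ N u v ∤N Ng≈uv ∣u₀ ∣v₀)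
        ...   | yes ∣u₀ | no  ∤v₀ = inj₂ (∤⇒bounded N u v ∤N Ng≈uv ∤v₀ ∣u₀)
        ...   | no  ∤u₀ | yes ∣v₀ = inj₁ (∤⇒bounded N v u ∤N (≈-trans Ng≈uv (*-comm u v)) ∤u₀ ∣v₀)
        ...   | no  ∤u₀ | no  ∤v₀ = ⊥-elim ([ ∤u₀ , ∤v₀ ]′ (prime-∣* (coeff u 0) (coeff v 0)
          (≡.subst (+ p ∣_) (constant-* N u v Ng≈uv) (∣n⇒∣m*n N (lower 0 0<m)))))

-- Norms and squares modulo 2 and modulo 4.

module SquareParityIdentities (R : CommutativeRing 0ℓ 0ℓ) where
  open CommutativeRing R
  open IntegerCoefficientSolver R
  open SetoidReasoning setoid

  two = 1# + 1#

  -- Modulo 2 the hypothesis reads E² − sO² ≡ (eP)² − s(eQ)².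
  difference-even : ∀ {s E O P Q e} → E * E - s * (O * O) ≈ e * e * (P * P + s * (Q * Q)) →
    (E + e * P) * (E + e * P) - s * ((O + e * Q) * (O + e * Q)) ≈
    two * (e * e * (P * P) + e * (E * P - s * (O * Q)))
  difference-even {s} {E} {O} {P} {Q} {e} h = begin
    (E + e * P) * (E + e * P) - s * ((O + e * Q) * (O + e * Q))
      ≈⟨ solve 6 (λ s E O P Q e →
           (E :+ e :* P) :* (E :+ e :* P) :- s :* ((O :+ e :* Q) :* (O :+ e :* Q)) :=
           (E :* E :- s :* (O :* O)) :+ (e :* e :* (P :* P :- s :* (Q :* Q)) :+ con (+ 2) :* (e :* (E :* P :- s :* (O :* Q)))))
           refl s E O P Q e ⟩
    (E * E - s * (O * O)) + (e * e * (P * P - s * (Q * Q)) + two * (e * (E * P - s * (O * Q))))   ≈⟨ +-congʳ h ⟩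
    e * e * (P * P + s * (Q * Q)) + (e * e * (P * P - s * (Q * Q)) + two * (e * (E * P - s * (O * Q))))
      ≈⟨ solve 6 (λ s E O P Q e →
           e :* e :* (P :* P :+ s :* (Q :* Q)) :+ (e :* e :* (P :* P :- s :* (Q :* Q)) :+ con (+ 2) :* (e :* (E :* P :- s :* (O :* Q)))) :=
           con (+ 2) :* (e :* e :* (P :* P) :+ e :* (E :* P :- s :* (O :* Q))))
           refl s E O P Q e ⟩
    two * (e * e * (P * P) + e * (E * P - s * (O * Q))) ∎

  -- Squaring E = 2D − eP and O = 2M − eQ gives E² ≡ e²P² and O² ≡ e²Q² modulo 4.
  twice-s-square : ∀ {s E O P Q e D M} → E * E - s * (O * O) ≈ e * e * (P * P + s * (Q * Q)) →
    E + e * P ≈ two * D → O + e * Q ≈ two * M →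
    two * (s * (e * Q * (e * Q))) ≈ two * (two * (D * D - D * (e * P) - s * (M * M - M * (e * Q))))
  twice-s-square {s} {E} {O} {P} {Q} {e} {D} {M} h E+eP≈2D O+eQ≈2M = begin
    two * (s * (e * Q * (e * Q)))
      ≈⟨ solve 4 (λ s P Q e → con (+ 2) :* (s :* (e :* Q :* (e :* Q))) :=
           e :* e :* (P :* P :+ s :* (Q :* Q)) :- (e :* P :* (e :* P) :- s :* (e :* Q :* (e :* Q))))
           refl s P Q e ⟩
    e * e * (P * P + s * (Q * Q)) - (e * P * (e * P) - s * (e * Q * (e * Q)))   ≈⟨ +-congʳ h ⟨
    E * E - s * (O * O) - (e * P * (e * P) - s * (e * Q * (e * Q)))
      ≈⟨ solve 6 (λ s E O P Q e →
           E :* E :- s :* (O :* O) :- (e :* P :* (e :* P) :- s :* (e :* Q :* (e :* Q))) :=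
           (E :+ e :* P) :* ((E :+ e :* P) :- con (+ 2) :* (e :* P)) :-
           s :* ((O :+ e :* Q) :* ((O :+ e :* Q) :- con (+ 2) :* (e :* Q))))
           refl s E O P Q e ⟩
    (E + e * P) * ((E + e * P) - two * (e * P)) - s * ((O + e * Q) * ((O + e * Q) - two * (e * Q)))
      ≈⟨ +-cong (*-cong E+eP≈2D (+-congʳ E+eP≈2D)) (-‿cong (*-congˡ (*-cong O+eQ≈2M (+-congʳ O+eQ≈2M)))) ⟩
    two * D * (two * D - two * (e * P)) - s * (two * M * (two * M - two * (e * Q)))
      ≈⟨ solve 6 (λ s P Q e D M →
           con (+ 2) :* D :* (con (+ 2) :* D :- con (+ 2) :* (e :* P)) :-
           s :* (con (+ 2) :* M :* (con (+ 2) :* M :- con (+ 2) :* (e :* Q))) :=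
           con (+ 2) :* (con (+ 2) :* (D :* D :- D :* (e :* P) :- s :* (M :* M :- M :* (e :* Q)))))
           refl s P Q e D M ⟩
    two * (two * (D * D - D * (e * P) - s * (M * M - M * (e * Q)))) ∎

  even-scalar : ∀ {s E O G e f} → E * E - s * (O * O) ≈ e * e * G → e ≈ two * f →
    E * E - s * (O * O) ≈ two * (two * (f * f * G))
  even-scalar {G = G} {e} {f} h e≈2f = trans h (trans (*-congʳ (*-cong e≈2f e≈2f))
    (solve 2 (λ f G → con (+ 2) :* f :* (con (+ 2) :* f) :* G := con (+ 2) :* (con (+ 2) :* (f :* f :* G))) refl f G))

  halve : ∀ {s E O E′ O′ K} → E * E - s * (O * O) ≈ two * (two * K) → E ≈ two * E′ → O ≈ two * O′ →
    two * (two * (E′ * E′ - s * (O′ * O′))) ≈ two * (two * K)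
  halve {s} {E} {O} {E′} {O′} h E≈2E′ O≈2O′ = trans
    (solve 3 (λ s E O → con (+ 2) :* (con (+ 2) :* (E :* E :- s :* (O :* O))) :=
      con (+ 2) :* E :* (con (+ 2) :* E) :- s :* (con (+ 2) :* O :* (con (+ 2) :* O))) refl s E′ O′)
    (trans (+-cong (*-cong (sym E≈2E′) (sym E≈2E′)) (-‿cong (*-congˡ (*-cong (sym O≈2O′) (sym O≈2O′))))) h)

module SquareParity where
  open import Data.Integer.Divisibility.Signed
  open IntegerPolynomials
  open SquareParityIdentities commutativeRing
  open PrimeModulus prime[2] using (prime-∣*; quotient-<)

  -- The polynomial s, written in the variable w = s + 4.
  X-4 : Poly
  X-4 = ℤ.- + 4 ∷ 1ℤ ∷ []

  X-4-* : ∀ p → X-4 * p ≈ (ℤ.- + 4) · p + (0ℤ ∷ p)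
  X-4-* p = +-congˡ ((ℤ.- + 4) · p) (∷-cong ≡.refl (*-identityˡ p))

  Even : Poly → Set
  Even = AllDivisible (+ 2)

  private
    2∣a+a : ∀ a → + 2 ∣ a ℤ.+ a
    2∣a+a a = divides a (≡.trans (≡.cong₂ ℤ._+_ (≡.sym (ℤₚ.*-identityʳ a)) (≡.sym (ℤₚ.*-identityʳ a)))
                                 (≡.sym (ℤₚ.*-distribˡ-+ a 1ℤ 1ℤ)))

    square-∷ : ∀ a p → (a ∷ p) * (a ∷ p) ≈ a ℤ.* a ∷ (a · p + a · p + (0ℤ ∷ p * p))
    square-∷ a p = ∷-cong (ℤₚ.+-identityʳ _)
      (≈-trans (+-congˡ (a · p) (*-∷ p a p)) (≈-sym (+-assoc (a · p) (a · p) (0ℤ ∷ p * p))))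

    coeff-double : ∀ a p q n → coeff (a · p + a · p + q) n ≡ (coeff (a · p) n ℤ.+ coeff (a · p) n) ℤ.+ coeff q n
    coeff-double a p q n = ≡.trans (coeff-+ (a · p + a · p) q n) (≡.cong (ℤ._+ coeff q n) (coeff-+ (a · p) (a · p) n))

  -- Modulo 2 the square of p(w) is p(w²), as the cross terms are doubled. This half concerns the
  -- odd exponents; `coeff-square-even` finds the root's coefficients at the even ones.
  coeff-square-odd : ∀ p k → + 2 ∣ coeff (p * p) (suc (k ℕ.* 2))
  coeff-square-odd []      k = divides 0ℤ ≡.refl
  coeff-square-odd (a ∷ p) k = ≡.subst (+ 2 ∣_)
    (≡.sym (≡.trans (coeff-≈ (square-∷ a p) (suc (k ℕ.* 2))) (coeff-double a p (0ℤ ∷ p * p) (k ℕ.* 2))))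
    (∣m∣n⇒∣m+n (2∣a+a (coeff (a · p) (k ℕ.* 2))) (tail k))
    where
    tail : ∀ k → + 2 ∣ coeff (0ℤ ∷ p * p) (k ℕ.* 2)
    tail zero    = divides 0ℤ ≡.refl
    tail (suc k) = coeff-square-odd p k

  coeff-square-even : ∀ p k → ∃ λ r → coeff (p * p) (k ℕ.* 2) ≡ coeff p k ℤ.* coeff p k ℤ.+ r × + 2 ∣ r
  coeff-square-even []      k       = 0ℤ , ≡.refl , divides 0ℤ ≡.refl
  coeff-square-even (a ∷ p) zero    = 0ℤ , ≡.refl , divides 0ℤ ≡.refl
  coeff-square-even (a ∷ p) (suc k) with coeff-square-even p k
  ... | r , eq , ∣r =
    coeff (a · p) (suc (k ℕ.* 2)) ℤ.+ coeff (a · p) (suc (k ℕ.* 2)) ℤ.+ r ,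
    ≡.trans (coeff-≈ (square-∷ a p) (suc (suc (k ℕ.* 2))))
      (≡.trans (coeff-double a p (0ℤ ∷ p * p) (suc (k ℕ.* 2)))
        (≡.trans (≡.cong (λ c → coeff (a · p) (suc (k ℕ.* 2)) ℤ.+ coeff (a · p) (suc (k ℕ.* 2)) ℤ.+ c) eq)
          (x∙yz≈y∙xz (coeff (a · p) (suc (k ℕ.* 2)) ℤ.+ coeff (a · p) (suc (k ℕ.* 2))) (coeff p k ℤ.* coeff p k) r))) ,
    ∣m∣n⇒∣m+n (2∣a+a (coeff (a · p) (suc (k ℕ.* 2)))) ∣r
    where
    open import Algebra.Properties.CommutativeSemigroup
      (CommutativeRing.+-commutativeSemigroup ℤₚ.+-*-commutativeRing) using (x∙yz≈y∙xz)

  private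
    even-root : ∀ p k → + 2 ∣ coeff (p * p) (k ℕ.* 2) → + 2 ∣ coeff p k
    even-root p k ∣pp = let (r , eq , ∣r) = coeff-square-even p k in
      Sum.reduce (prime-∣* (coeff p k) (coeff p k) (∣m+n∣n⇒∣m (≡.subst (+ 2 ∣_) eq ∣pp) ∣r))

  -- Modulo 2 squares are polynomials in X², and X − 4 ≡ X.
  square-parity : ∀ E O K → E * E + - (X-4 * (O * O)) ≈ C (+ 2) * K → Even E × Even O
  square-parity E O K h = mkAllDivisible even-E , mkAllDivisible even-O
    where
    difference : ∀ n → + 2 ∣ coeff (E * E) n ℤ.- coeff (0ℤ ∷ O * O) n
    difference n = ∣m+n∣n⇒∣m {n = + 4 ℤ.* coeff (O * O) n} (≡.subst (+ 2 ∣_) eq (coeff-∣ (AllDivisible-C* (+ 2) K) n))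
      (∣m⇒∣m*n (coeff (O * O) n) (divides (+ 2) ≡.refl))
      where
      open ≡.≡-Reasoning
      open IntegerCoefficientSolver ℤₚ.+-*-commutativeRing
      eq : coeff (C (+ 2) * K) n ≡ (coeff (E * E) n ℤ.- coeff (0ℤ ∷ O * O) n) ℤ.+ + 4 ℤ.* coeff (O * O) n
      eq = begin
        coeff (C (+ 2) * K) n                                             ≡⟨ coeff-≈ h n ⟨
        coeff (E * E + - (X-4 * (O * O))) n                               ≡⟨ coeff-+ (E * E) (- (X-4 * (O * O))) n ⟩
        coeff (E * E) n ℤ.+ coeff (- (X-4 * (O * O))) n                   ≡⟨ ≡.cong (λ c → coeff (E * E) n ℤ.+ c) (coeff-neg (X-4 * (O * O)) n) ⟩
        coeff (E * E) n ℤ.- coeff (X-4 * (O * O)) n                       ≡⟨ ≡.cong (λ c → coeff (E * E) n ℤ.- c) (coeff-≈ (X-4-* (O * O)) n) ⟩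
        coeff (E * E) n ℤ.- coeff ((ℤ.- + 4) · (O * O) + (0ℤ ∷ O * O)) n
          ≡⟨ ≡.cong (λ c → coeff (E * E) n ℤ.- c) (≡.trans (coeff-+ ((ℤ.- + 4) · (O * O)) (0ℤ ∷ O * O) n)
               (≡.cong (ℤ._+ coeff (0ℤ ∷ O * O) n) (coeff-· (ℤ.- + 4) (O * O) n))) ⟩
        coeff (E * E) n ℤ.- ((ℤ.- + 4) ℤ.* coeff (O * O) n ℤ.+ coeff (0ℤ ∷ O * O) n)
          ≡⟨ solve 3 (λ a b c → a :- (con (ℤ.- + 4) :* b :+ c) := (a :- c) :+ con (+ 4) :* b) ≡.refl
               (coeff (E * E) n) (coeff (O * O) n) (coeff (0ℤ ∷ O * O) n) ⟩
        (coeff (E * E) n ℤ.- coeff (0ℤ ∷ O * O) n) ℤ.+ + 4 ℤ.* coeff (O * O) n ∎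

    even-E : ∀ k → + 2 ∣ coeff E k
    even-E zero    = even-root E 0 (≡.subst (+ 2 ∣_) (ℤₚ.+-identityʳ _) (difference 0))
    even-E (suc k) = even-root E (suc k)
      (∣m+n∣n⇒∣m (difference (suc k ℕ.* 2)) (∣m⇒∣-m (coeff-square-odd O k)))

    even-O : ∀ k → + 2 ∣ coeff O k
    even-O k = even-root O k (∣-neg (∣m+n∣m⇒∣n (difference (suc (k ℕ.* 2))) (coeff-square-odd E k)))
      where
      ∣-neg : ∀ {a} → + 2 ∣ ℤ.- a → + 2 ∣ a
      ∣-neg {a} ∣-a = ≡.subst (+ 2 ∣_) (ℤₚ.neg-involutive a) (∣m⇒∣-m ∣-a)

  -- The condition e ≠ 0 excludes the solution E = O = 0 and makes the repeated halving of e arrive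
  -- at an odd number. There one odd coefficient of Q is enough, since all of e Q is shown to be
  -- even.
  no-proportional-norm : ∀ P Q j → ¬ + 2 ∣ coeff Q j → ∀ e → e ≢ 0ℤ → ∀ E O →
    ¬ E * E + - (X-4 * (O * O)) ≈ C e * C e * (P * P + X-4 * (Q * Q))
  no-proportional-norm P Q j ∤Qⱼ e = go e (<-wellFounded ℤ.∣ e ∣)
    where
    G = P * P + X-4 * (Q * Q)

    go : ∀ e → Acc _<_ ℤ.∣ e ∣ → e ≢ 0ℤ → ∀ E O → ¬ E * E + - (X-4 * (O * O)) ≈ C e * C e * G
    go e (acc rec) e≢0 E O h with + 2 ∣? e
    ... | yes (divides f e≡f2) = go f (rec (quotient-< f e≢0 e≡f2)) f≢0 E′ O′
      (C*-cancel {+ 2} (λ ()) (C*-cancel {+ 2} (λ ()) (halve {X-4} {E} {O} {E′} {O′} {C f * C f * G} h₄ E≈ O≈)))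
      where
      f≢0 : f ≢ 0ℤ
      f≢0 f≡0 = e≢0 (≡.trans e≡f2 (≡.cong (ℤ._* + 2) f≡0))

      h₄ : E * E + - (X-4 * (O * O)) ≈ C (+ 2) * (C (+ 2) * (C f * C f * G))
      h₄ = even-scalar {X-4} {E} {O} {G} {C e} {C f} h
        (≈-trans (∷-cong (≡.trans e≡f2 (ℤₚ.*-comm f (+ 2))) ≈-refl) (≈-sym (C-* (+ 2) (C f))))

      parity : Even E × Even O
      parity = square-parity E O (C (+ 2) * (C f * C f * G)) h₄

      E′ O′ : Poly
      E′ = proj₁ (quotient-C* E (proj₁ parity))
      O′ = proj₁ (quotient-C* O (proj₂ parity))

      E≈ : E ≈ C (+ 2) * E′
      E≈ = proj₂ (quotient-C* E (proj₁ parity))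

      O≈ : O ≈ C (+ 2) * O′
      O≈ = proj₂ (quotient-C* O (proj₂ parity))
    ... | no ∤e = [ ∤e , ∤Qⱼ ]′ (prime-∣* e (coeff Q j) (≡.subst (+ 2 ∣_) (coeff-C* e Q j) (coeff-∣ even-eQ j)))
      where
      parity : Even (E + C e * P) × Even (O + C e * Q)
      parity = square-parity (E + C e * P) (O + C e * Q) _ (difference-even {X-4} {E} {O} {P} {Q} {C e} h)

      D M L : Poly
      D = proj₁ (quotient-C* (E + C e * P) (proj₁ parity))
      M = proj₁ (quotient-C* (O + C e * Q) (proj₂ parity))
      L = D * D + - (D * (C e * P)) + - (X-4 * (M * M + - (M * (C e * Q))))

      s-square : X-4 * (C e * Q * (C e * Q)) ≈ C (+ 2) * L
      s-square = C*-cancel {+ 2} (λ ()) (twice-s-square {X-4} {E} {O} {P} {Q} {C e} {D} {M} h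
        (proj₂ (quotient-C* (E + C e * P) (proj₁ parity))) (proj₂ (quotient-C* (O + C e * Q) (proj₂ parity))))

      even-eQ : Even (C e * Q)
      -- The parity lemma once more, now with first component 0: the norm -s(eQ)² is even, hence so
      -- is e Q.
      even-eQ = proj₂ (square-parity [] (C e * Q) (- L) (≈-trans (-‿cong s-square) (-‿distribʳ-* (C (+ 2)) L)))
        where open import Algebra.Properties.Ring (CommutativeRing.ring commutativeRing) using (-‿distribʳ-*)

-- Fibonacci polynomials split by the parity of the index.

-- With t² = s, the Fibonacci polynomials are F₂ₙ₊₁(t) = P n and
-- F₂ₙ(t) = t Q n.
module FibonacciHalves (R : CommutativeRing 0ℓ 0ℓ) (s : CommutativeRing.Carrier R) where
  open CommutativeRing R
  open IntegerCoefficientSolver R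
  open SetoidReasoning setoid

  P Q : ℕ → Carrier
  P zero    = 1#
  P (suc n) = s * Q (suc n) + P n
  Q zero    = 0#
  Q (suc n) = P n + Q n

  -- Two Fibonacci steps at once: t² + 2 and 1 are the trace and the determinant of the square of
  -- the matrix with rows (t, 1) and (1, 0).
  P-recurrence : ∀ n → P (suc (suc n)) ≈ s * P (suc n) + (P (suc n) + P (suc n)) - P n
  P-recurrence n = solve 3 (λ s p q →
      s :* ((s :* (p :+ q) :+ p) :+ (p :+ q)) :+ (s :* (p :+ q) :+ p) :=
      s :* (s :* (p :+ q) :+ p) :+ ((s :* (p :+ q) :+ p) :+ (s :* (p :+ q) :+ p)) :- p)
    refl s (P n) (Q n)

  s*Q : ∀ n → s * Q (suc n) ≈ P (suc n) - P n
  s*Q n = solve 3 (λ s p q → s :* (p :+ q) := s :* (p :+ q) :+ p :- p) refl s (P n) (Q n)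

  -- F₂ₘ₊₁ = Fₘ² + Fₘ₊₁² and F₂ₘ = Fₘ (Fₘ₊₁ + Fₘ₋₁) at m = 2n and m = 2n + 1.
  P-even : ∀ n → P (n ℕ.* 2) ≈ P n * P n + s * (Q n * Q n)
  P-odd  : ∀ n → P (suc (n ℕ.* 2)) ≈ P n * P n + s * (Q (suc n) * Q (suc n))
  Q-odd  : ∀ n → Q (suc (n ℕ.* 2)) ≈ P n * (Q n + Q (suc n))

  P-even zero    = solve 1 (λ s → con 1ℤ := con 1ℤ :* con 1ℤ :+ s :* (con 0ℤ :* con 0ℤ)) refl s
  P-even (suc n) = begin
    s * (P (suc (n ℕ.* 2)) + Q (suc (n ℕ.* 2))) + P (suc (n ℕ.* 2))
      ≈⟨ +-cong (*-congˡ (+-cong (P-odd n) (Q-odd n))) (P-odd n) ⟩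
    s * (P n * P n + s * (Q (suc n) * Q (suc n)) + P n * (Q n + Q (suc n))) + (P n * P n + s * (Q (suc n) * Q (suc n)))
      ≈⟨ solve 3 (λ s p q →
           s :* (p :* p :+ s :* ((p :+ q) :* (p :+ q)) :+ p :* (q :+ (p :+ q))) :+ (p :* p :+ s :* ((p :+ q) :* (p :+ q))) :=
           (s :* (p :+ q) :+ p) :* (s :* (p :+ q) :+ p) :+ s :* ((p :+ q) :* (p :+ q)))
           refl s (P n) (Q n) ⟩
    P (suc n) * P (suc n) + s * (Q (suc n) * Q (suc n)) ∎

  P-odd n = begin
    s * Q (suc (n ℕ.* 2)) + P (n ℕ.* 2)     ≈⟨ +-cong (*-congˡ (Q-odd n)) (P-even n) ⟩
    s * (P n * (Q n + Q (suc n))) + (P n * P n + s * (Q n * Q n))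
      ≈⟨ solve 3 (λ s p q →
           s :* (p :* (q :+ (p :+ q))) :+ (p :* p :+ s :* (q :* q)) :=
           p :* p :+ s :* ((p :+ q) :* (p :+ q)))
           refl s (P n) (Q n) ⟩
    P n * P n + s * (Q (suc n) * Q (suc n)) ∎

  Q-odd zero    = solve 0 (con 1ℤ :+ con 0ℤ := con 1ℤ :* (con 0ℤ :+ (con 1ℤ :+ con 0ℤ))) refl
  Q-odd (suc n) = begin
    P (suc n ℕ.* 2) + (P (suc (n ℕ.* 2)) + Q (suc (n ℕ.* 2)))
      ≈⟨ +-cong (P-even (suc n)) (+-cong (P-odd n) (Q-odd n)) ⟩
    P (suc n) * P (suc n) + s * (Q (suc n) * Q (suc n)) + (P n * P n + s * (Q (suc n) * Q (suc n)) + P n * (Q n + Q (suc n)))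
      ≈⟨ solve 3 (λ s p q → let q′ = p :+ q ; p′ = s :* q′ :+ p in
           p′ :* p′ :+ s :* (q′ :* q′) :+ (p :* p :+ s :* (q′ :* q′) :+ p :* (q :+ q′)) :=
           p′ :* (q′ :+ (p′ :+ q′)))
           refl s (P n) (Q n) ⟩
    P (suc n) * (Q (suc n) + Q (suc (suc n))) ∎

-- Coefficients of P n in powers of w, and the Eisenstein property.

module CoefficientFormula where
  open import Data.Integer.Divisibility.Signed

  -- This is (2n+1)/(2j+1) · (n+j choose 2j) without its division, so that it is visibly a natural
  -- number and Pascal's rule applies to it.
  h : ℕ → ℕ → ℕ
  h n j = (n ℕ.+ j) choose (j ℕ.* 2) ℕ.+ 2 ℕ.* ((n ℕ.+ j) choose suc (j ℕ.* 2))

  -- The identity (k+1) (n choose k+1) = (n-k) (n choose k), with the subtraction moved to the other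
  -- side.
  absorption : ∀ n k → suc k ℕ.* (n choose suc k) ℕ.+ k ℕ.* (n choose k) ≡ n ℕ.* (n choose k)
  absorption zero    zero    = ≡.refl
  absorption zero    (suc k) = ≡.trans (≡.cong₂ (λ x y → suc (suc k) ℕ.* x ℕ.+ suc k ℕ.* y)
      (k>n⇒nCk≡0 (s≤s (z≤n {suc k}))) (k>n⇒nCk≡0 (s≤s (z≤n {k}))))
    (≡.cong₂ ℕ._+_ (ℕₚ.*-zeroʳ k) (ℕₚ.*-zeroʳ k))
  absorption (suc n) zero    = ≡.trans (ℕₚ.+-identityʳ _) (≡.trans (ℕₚ.*-identityˡ _)
    (≡.trans (nC1≡n (suc n)) (≡.sym (ℕₚ.*-identityʳ (suc n)))))
  absorption (suc n) (suc k) = begin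
    suc (suc k) ℕ.* (suc n choose suc (suc k)) ℕ.+ suc k ℕ.* (suc n choose suc k)
      ≡⟨ ≡.cong₂ (λ x y → suc (suc k) ℕ.* x ℕ.+ suc k ℕ.* y) (nCk+nC[k+1]≡[n+1]C[k+1] n (suc k)) (nCk+nC[k+1]≡[n+1]C[k+1] n k) ⟨
    suc (suc k) ℕ.* (b ℕ.+ c) ℕ.+ suc k ℕ.* (a ℕ.+ b)
      ≡⟨ solve 4 (λ k a b c → (con 2 :+ k) :* (b :+ c) :+ (con 1 :+ k) :* (a :+ b) :=
           ((con 2 :+ k) :* c :+ (con 1 :+ k) :* b) :+ ((con 1 :+ k) :* b :+ k :* a) :+ (a :+ b)) ≡.refl k a b c ⟩
    (suc (suc k) ℕ.* c ℕ.+ suc k ℕ.* b) ℕ.+ (suc k ℕ.* b ℕ.+ k ℕ.* a) ℕ.+ (a ℕ.+ b)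
      ≡⟨ ≡.cong₂ (λ x y → x ℕ.+ y ℕ.+ (a ℕ.+ b)) (absorption n (suc k)) (absorption n k) ⟩
    n ℕ.* b ℕ.+ n ℕ.* a ℕ.+ (a ℕ.+ b)
      ≡⟨ solve 3 (λ n a b → n :* b :+ n :* a :+ (a :+ b) := (con 1 :+ n) :* (a :+ b)) ≡.refl n a b ⟩
    suc n ℕ.* (a ℕ.+ b)
      ≡⟨ ≡.cong (suc n ℕ.*_) (nCk+nC[k+1]≡[n+1]C[k+1] n k) ⟩
    suc n ℕ.* (suc n choose suc k) ∎
    where
    open ≡.≡-Reasoning
    open ℕ.+-*-Solver
    a = n choose k
    b = n choose suc k
    c = n choose suc (suc k)

  -- Recovers the quotient form of `h`, from which a prime 2n + 1 is seen to divide h n j for j < n.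
  -- The common summand 2 · 2j · (n+j choose 2j) is added to both sides so that `absorption` applies
  -- without subtraction.
  h-absorption : ∀ n j → suc (j ℕ.* 2) ℕ.* h n j ≡ suc (n ℕ.* 2) ℕ.* ((n ℕ.+ j) choose (j ℕ.* 2))
  h-absorption n j = ℕₚ.+-cancelʳ-≡ (2 ℕ.* (j ℕ.* 2 ℕ.* a)) _ _ (begin
    suc (j ℕ.* 2) ℕ.* (a ℕ.+ 2 ℕ.* b) ℕ.+ 2 ℕ.* (j ℕ.* 2 ℕ.* a)
      ≡⟨ solve 3 (λ k a b → (con 1 :+ k) :* (a :+ con 2 :* b) :+ con 2 :* (k :* a) :=
           (con 1 :+ k) :* a :+ con 2 :* ((con 1 :+ k) :* b :+ k :* a)) ≡.refl (j ℕ.* 2) a b ⟩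
    suc (j ℕ.* 2) ℕ.* a ℕ.+ 2 ℕ.* (suc (j ℕ.* 2) ℕ.* b ℕ.+ j ℕ.* 2 ℕ.* a)
      ≡⟨ ≡.cong (λ x → suc (j ℕ.* 2) ℕ.* a ℕ.+ 2 ℕ.* x) (absorption (n ℕ.+ j) (j ℕ.* 2)) ⟩
    suc (j ℕ.* 2) ℕ.* a ℕ.+ 2 ℕ.* ((n ℕ.+ j) ℕ.* a)
      ≡⟨ solve 3 (λ n j a → (con 1 :+ j :* con 2) :* a :+ con 2 :* ((n :+ j) :* a) :=
           (con 1 :+ n :* con 2) :* a :+ con 2 :* (j :* con 2 :* a)) ≡.refl n j a ⟩
    suc (n ℕ.* 2) ℕ.* a ℕ.+ 2 ℕ.* (j ℕ.* 2 ℕ.* a) ∎)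
    where
    open ≡.≡-Reasoning
    open ℕ.+-*-Solver
    a = (n ℕ.+ j) choose (j ℕ.* 2)
    b = (n ℕ.+ j) choose suc (j ℕ.* 2)

  -- By Pascal's rule the difference in the upper argument lowers the lower one by 1; here it is
  -- taken twice.
  C-second-difference : ∀ n r → suc (suc n) choose suc (suc r) ℕ.+ n choose suc (suc r) ≡ n choose r ℕ.+ 2 ℕ.* (suc n choose suc (suc r))
  C-second-difference n r = begin
    suc (suc n) choose suc (suc r) ℕ.+ c                                    ≡⟨ ≡.cong (ℕ._+ c) (pascal (suc n) (suc r)) ⟨
    (suc n choose suc r ℕ.+ suc n choose suc (suc r)) ℕ.+ c                      ≡⟨ ≡.cong (λ x → x ℕ.+ suc n choose suc (suc r) ℕ.+ c) (pascal n r) ⟨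
    ((n choose r ℕ.+ b) ℕ.+ suc n choose suc (suc r)) ℕ.+ c
      ≡⟨ solve 4 (λ a b c d → ((a :+ b) :+ d) :+ c := a :+ ((b :+ c) :+ d)) ≡.refl (n choose r) b c (suc n choose suc (suc r)) ⟩
    n choose r ℕ.+ ((b ℕ.+ c) ℕ.+ suc n choose suc (suc r))                      ≡⟨ ≡.cong (λ x → n choose r ℕ.+ (x ℕ.+ suc n choose suc (suc r))) (pascal n (suc r)) ⟩
    n choose r ℕ.+ (suc n choose suc (suc r) ℕ.+ suc n choose suc (suc r))
      ≡⟨ solve 2 (λ a d → a :+ (d :+ d) := a :+ con 2 :* d) ≡.refl (n choose r) (suc n choose suc (suc r)) ⟩
    n choose r ℕ.+ 2 ℕ.* (suc n choose suc (suc r))                              ∎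
    where
    open ≡.≡-Reasoning
    open ℕ.+-*-Solver
    pascal = nCk+nC[k+1]≡[n+1]C[k+1]
    b = n choose suc r
    c = n choose suc (suc r)

  h-zero : ∀ n → h n 0 ≡ suc (n ℕ.* 2)
  h-zero n = ≡.cong suc (≡.trans (≡.cong (2 ℕ.*_) (≡.trans (nC1≡n (n ℕ.+ 0)) (ℕₚ.+-identityʳ n))) (ℕₚ.*-comm 2 n))

  h-diagonal : ∀ n → h n n ≡ 1
  h-diagonal n = ≡.cong₂ (λ x y → x ℕ.+ 2 ℕ.* y)
    (≡.trans (≡.cong ((n ℕ.+ n) choose_) n*2≡n+n) (nCn≡1 (n ℕ.+ n)))
    (k>n⇒nCk≡0 (s≤s (ℕₚ.≤-reflexive (≡.sym n*2≡n+n))))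
    where
    n*2≡n+n : n ℕ.* 2 ≡ n ℕ.+ n
    n*2≡n+n = ≡.trans (ℕₚ.*-comm n 2) (≡.cong (n ℕ.+_) (ℕₚ.+-identityʳ n))

  h-above : ∀ n j → n < j → h n j ≡ 0
  h-above n j n<j = ≡.cong₂ (λ x y → x ℕ.+ 2 ℕ.* y) (k>n⇒nCk≡0 n+j<j*2) (k>n⇒nCk≡0 (ℕₚ.m<n⇒m<1+n n+j<j*2))
    where
    n+j<j*2 : n ℕ.+ j < j ℕ.* 2
    n+j<j*2 = ≡.subst (n ℕ.+ j <_) (≡.trans (≡.cong (j ℕ.+_) (≡.sym (ℕₚ.+-identityʳ j))) (ℕₚ.*-comm 2 j)) (ℕₚ.+-monoˡ-< j n<j)

  h-recurrence-zero : ∀ n → h (suc (suc n)) 0 ℕ.+ h n 0 ≡ 2 ℕ.* h (suc n) 0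
  h-recurrence-zero n = ≡.trans (≡.cong₂ ℕ._+_ (h-zero (suc (suc n))) (h-zero n))
    (≡.trans (solve 1 (λ n → (con 5 :+ n :* con 2) :+ (con 1 :+ n :* con 2) := con 2 :* (con 3 :+ n :* con 2)) ≡.refl n)
      (≡.cong (2 ℕ.*_) (≡.sym (h-zero (suc n)))))
    where open ℕ.+-*-Solver

  -- The recurrence P(n+2) = (w - 2) P(n+1) - P(n) read off at a coefficient, after removal of the
  -- sign (-1)ⁿ⁺ʲ; the subtracted term stands on the left to remain in ℕ.
  h-recurrence-suc : ∀ n j → h (suc (suc n)) (suc j) ℕ.+ h n (suc j) ≡ h (suc n) j ℕ.+ 2 ℕ.* h (suc n) (suc j)
  h-recurrence-suc n j = begin
    h (suc (suc n)) (suc j) ℕ.+ h n (suc j)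
      ≡⟨ solve 4 (λ a b c d → (a :+ con 2 :* b) :+ (c :+ con 2 :* d) := (a :+ c) :+ con 2 :* (b :+ d)) ≡.refl
           (suc (suc N) choose suc (suc (j ℕ.* 2))) (suc (suc N) choose suc (suc (suc (j ℕ.* 2))))
           (N choose suc (suc (j ℕ.* 2))) (N choose suc (suc (suc (j ℕ.* 2)))) ⟩
    (suc (suc N) choose suc (suc (j ℕ.* 2)) ℕ.+ N choose suc (suc (j ℕ.* 2))) ℕ.+
    2 ℕ.* (suc (suc N) choose suc (suc (suc (j ℕ.* 2))) ℕ.+ N choose suc (suc (suc (j ℕ.* 2))))
      ≡⟨ ≡.cong₂ (λ x y → x ℕ.+ 2 ℕ.* y) (C-second-difference N (j ℕ.* 2)) (C-second-difference N (suc (j ℕ.* 2))) ⟩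
    (N choose (j ℕ.* 2) ℕ.+ 2 ℕ.* u) ℕ.+ 2 ℕ.* (N choose suc (j ℕ.* 2) ℕ.+ 2 ℕ.* v)
      ≡⟨ solve 4 (λ a b u v → (a :+ con 2 :* u) :+ con 2 :* (b :+ con 2 :* v) :=
           (a :+ con 2 :* b) :+ con 2 :* (u :+ con 2 :* v)) ≡.refl (N choose (j ℕ.* 2)) (N choose suc (j ℕ.* 2)) u v ⟩
    (N choose (j ℕ.* 2) ℕ.+ 2 ℕ.* (N choose suc (j ℕ.* 2))) ℕ.+ 2 ℕ.* h (suc n) (suc j)
      ≡⟨ ≡.cong (λ M → (M choose (j ℕ.* 2) ℕ.+ 2 ℕ.* (M choose suc (j ℕ.* 2))) ℕ.+ 2 ℕ.* h (suc n) (suc j)) (ℕₚ.+-suc n j) ⟩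
    h (suc n) j ℕ.+ 2 ℕ.* h (suc n) (suc j) ∎
    where
    open ≡.≡-Reasoning
    open ℕ.+-*-Solver
    N = n ℕ.+ suc j
    u = suc N choose suc (suc (j ℕ.* 2))
    v = suc N choose suc (suc (suc (j ℕ.* 2)))

  open IntegerPolynomials
  open SquareParity using (X-4; X-4-*)
  open FibonacciHalves commutativeRing X-4 public

  ε : ℕ → ℤ
  ε zero    = 1ℤ
  ε (suc n) = ℤ.- ε n

  ε²≡1 : ∀ n → ε n ℤ.* ε n ≡ 1ℤ
  ε²≡1 zero    = ≡.refl
  ε²≡1 (suc n) = ≡.trans (solve 1 (λ x → :- x :* :- x := x :* x) ≡.refl (ε n)) (ε²≡1 n)
    where open IntegerCoefficientSolver ℤₚ.+-*-commutativeRing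

  private
    coeff-P-suc² : ∀ n j → coeff (P (suc (suc n))) j ≡
                   coeff (0ℤ ∷ P (suc n)) j ℤ.- + 2 ℤ.* coeff (P (suc n)) j ℤ.- coeff (P n) j
    coeff-P-suc² n j = begin
      coeff (P (suc (suc n))) j                              ≡⟨ coeff-≈ (P-recurrence n) j ⟩
      coeff (X-4 * p + (p + p) + - P n) j                    ≡⟨ coeff-+ (X-4 * p + (p + p)) (- P n) j ⟩
      coeff (X-4 * p + (p + p)) j ℤ.+ coeff (- P n) j
        ≡⟨ ≡.cong₂ ℤ._+_ (≡.trans (coeff-+ (X-4 * p) (p + p) j) (≡.cong₂ ℤ._+_
             (≡.trans (coeff-≈ (X-4-* p) j) (≡.trans (coeff-+ ((ℤ.- + 4) · p) (0ℤ ∷ p) j) (≡.cong (ℤ._+ coeff (0ℤ ∷ p) j) (coeff-· (ℤ.- + 4) p j))))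
             (coeff-+ p p j))) (coeff-neg (P n) j) ⟩
      ((ℤ.- + 4) ℤ.* coeff p j ℤ.+ coeff (0ℤ ∷ p) j ℤ.+ (coeff p j ℤ.+ coeff p j)) ℤ.- coeff (P n) j
        ≡⟨ solve 3 (λ a b c → (con (ℤ.- + 4) :* a :+ b :+ (a :+ a)) :- c := b :- con (+ 2) :* a :- c) ≡.refl
             (coeff p j) (coeff (0ℤ ∷ p) j) (coeff (P n) j) ⟩
      coeff (0ℤ ∷ p) j ℤ.- + 2 ℤ.* coeff p j ℤ.- coeff (P n) j ∎
      where
      open ≡.≡-Reasoning
      open IntegerCoefficientSolver ℤₚ.+-*-commutativeRing
      p = P (suc n)

    pos-recurrence-zero : ∀ n → + h (suc (suc n)) 0 ℤ.+ + h n 0 ≡ + 2 ℤ.* + h (suc n) 0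
    pos-recurrence-zero n = ≡.trans (≡.sym (ℤₚ.pos-+ (h (suc (suc n)) 0) (h n 0)))
      (≡.trans (≡.cong +_ (h-recurrence-zero n)) (ℤₚ.pos-* 2 (h (suc n) 0)))

    pos-recurrence-suc : ∀ n j → + h (suc (suc n)) (suc j) ℤ.+ + h n (suc j) ≡ + h (suc n) j ℤ.+ + 2 ℤ.* + h (suc n) (suc j)
    pos-recurrence-suc n j = ≡.trans (≡.sym (ℤₚ.pos-+ (h (suc (suc n)) (suc j)) (h n (suc j))))
      (≡.trans (≡.cong +_ (h-recurrence-suc n j)) (≡.trans (ℤₚ.pos-+ (h (suc n) j) (2 ℕ.* h (suc n) (suc j)))
        (≡.cong (λ x → + h (suc n) j ℤ.+ x) (ℤₚ.pos-* 2 (h (suc n) (suc j))))))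

  -- F₂ₙ₊₁(t) = Σⱼ (−1)ⁿ⁺ʲ h n j (t² + 4)ʲ
  coeff-P : ∀ n j → coeff (P n) j ≡ ε n ℤ.* ε j ℤ.* + h n j
  coeff-P zero zero = ≡.refl
  coeff-P zero (suc j) = ≡.sym (≡.trans (≡.cong (λ x → 1ℤ ℤ.* ε (suc j) ℤ.* + x) (h-above 0 (suc j) (s≤s z≤n))) (ℤₚ.*-zeroʳ (1ℤ ℤ.* ε (suc j))))
  coeff-P (suc zero) zero = ≡.refl
  coeff-P (suc zero) (suc zero) = ≡.refl
  coeff-P (suc zero) (suc (suc j)) = ≡.sym (≡.trans (≡.cong (λ x → ε 1 ℤ.* ε (suc (suc j)) ℤ.* + x) (h-above 1 (suc (suc j)) (s≤s (s≤s z≤n)))) (ℤₚ.*-zeroʳ (ε 1 ℤ.* ε (suc (suc j)))))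
  coeff-P (suc (suc n)) zero = begin
    coeff (P (suc (suc n))) 0                                                ≡⟨ coeff-P-suc² n 0 ⟩
    0ℤ ℤ.- + 2 ℤ.* coeff (P (suc n)) 0 ℤ.- coeff (P n) 0
      ≡⟨ ≡.cong₂ (λ x y → 0ℤ ℤ.- + 2 ℤ.* x ℤ.- y) (coeff-P (suc n) 0) (coeff-P n 0) ⟩
    0ℤ ℤ.- + 2 ℤ.* (ε (suc n) ℤ.* 1ℤ ℤ.* b) ℤ.- ε n ℤ.* 1ℤ ℤ.* c
      ≡⟨ solve 3 (λ x b c → con 0ℤ :- con (+ 2) :* (:- x :* con 1ℤ :* b) :- x :* con 1ℤ :* c := x :* (con (+ 2) :* b :- c)) ≡.refl (ε n) b c ⟩
    ε n ℤ.* (+ 2 ℤ.* b ℤ.- c)                                                ≡⟨ ≡.cong (λ z → ε n ℤ.* (z ℤ.- c)) (pos-recurrence-zero n) ⟨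
    ε n ℤ.* (a ℤ.+ c ℤ.- c)
      ≡⟨ solve 3 (λ x a c → x :* (a :+ c :- c) := :- (:- x) :* con 1ℤ :* a) ≡.refl (ε n) a c ⟩
    ε (suc (suc n)) ℤ.* 1ℤ ℤ.* a                                             ∎
    where
    open ≡.≡-Reasoning
    open IntegerCoefficientSolver ℤₚ.+-*-commutativeRing
    a = + h (suc (suc n)) 0
    b = + h (suc n) 0
    c = + h n 0
  coeff-P (suc (suc n)) (suc j) = begin
    coeff (P (suc (suc n))) (suc j)                                          ≡⟨ coeff-P-suc² n (suc j) ⟩
    coeff (P (suc n)) j ℤ.- + 2 ℤ.* coeff (P (suc n)) (suc j) ℤ.- coeff (P n) (suc j)
      ≡⟨ ≡.cong₂ ℤ._-_ (≡.cong₂ (λ x y → x ℤ.- + 2 ℤ.* y) (coeff-P (suc n) j) (coeff-P (suc n) (suc j))) (coeff-P n (suc j)) ⟩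
    ε (suc n) ℤ.* ε j ℤ.* d ℤ.- + 2 ℤ.* (ε (suc n) ℤ.* ε (suc j) ℤ.* b) ℤ.- ε n ℤ.* ε (suc j) ℤ.* c
      ≡⟨ solve 5 (λ x y b c d → (:- x) :* y :* d :- con (+ 2) :* (:- x :* :- y :* b) :- x :* :- y :* c := :- (x :* y) :* (d :+ con (+ 2) :* b :- c)) ≡.refl (ε n) (ε j) b c d ⟩
    ℤ.- (ε n ℤ.* ε j) ℤ.* (d ℤ.+ + 2 ℤ.* b ℤ.- c)                              ≡⟨ ≡.cong (λ z → ℤ.- (ε n ℤ.* ε j) ℤ.* (z ℤ.- c)) (pos-recurrence-suc n j) ⟨
    ℤ.- (ε n ℤ.* ε j) ℤ.* (a ℤ.+ c ℤ.- c)
      ≡⟨ solve 4 (λ x y a c → :- (x :* y) :* (a :+ c :- c) := :- (:- x) :* :- y :* a) ≡.refl (ε n) (ε j) a c ⟩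
    ε (suc (suc n)) ℤ.* ε (suc j) ℤ.* a                                      ∎
    where
    open ≡.≡-Reasoning
    open IntegerCoefficientSolver ℤₚ.+-*-commutativeRing
    a = + h (suc (suc n)) (suc j)
    b = + h (suc n) (suc j)
    c = + h n (suc j)
    d = + h (suc n) j

  coeff-P-above : ∀ n j → n < j → coeff (P n) j ≡ 0ℤ
  coeff-P-above n j n<j = ≡.trans (coeff-P n j)
    (≡.trans (≡.cong (λ x → ε n ℤ.* ε j ℤ.* + x) (h-above n j n<j)) (ℤₚ.*-zeroʳ (ε n ℤ.* ε j)))

  coeff-P-leading : ∀ n → coeff (P n) n ≡ 1ℤ
  coeff-P-leading n = ≡.trans (coeff-P n n)
    (≡.trans (≡.cong₂ (λ x y → x ℤ.* + y) (ε²≡1 n) (h-diagonal n)) ≡.refl)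

  -- The leading coefficient of s Q(n+1) = P(n+1) - P(n) is 1. As s = w - 4, it is also the
  -- coefficient of Q(n+1) at n minus a multiple of 4, so the former is odd.
  Q-odd-coefficient : ∀ n → ¬ + 2 ∣ coeff (Q (suc n)) n
  Q-odd-coefficient n 2∣q = contradiction (∣⇒∣ᵤ (∣m+n∣n⇒∣m {m = 1ℤ} {n = + 4 ℤ.* coeff (Q (suc n)) (suc n)} (≡.subst (+ 2 ∣_) eq 2∣q)
    (∣m⇒∣m*n (coeff (Q (suc n)) (suc n)) (divides (+ 2) ≡.refl)))) (ℕ.>⇒∤ (s≤s (s≤s z≤n)))
    where
    open ≡.≡-Reasoning
    open IntegerCoefficientSolver ℤₚ.+-*-commutativeRing
    q = Q (suc n)

    difference : (ℤ.- + 4) ℤ.* coeff q (suc n) ℤ.+ coeff q n ≡ 1ℤ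
    difference = begin
      (ℤ.- + 4) ℤ.* coeff q (suc n) ℤ.+ coeff q n         ≡⟨ ≡.cong (ℤ._+ coeff q n) (coeff-· (ℤ.- + 4) q (suc n)) ⟨
      coeff ((ℤ.- + 4) · q) (suc n) ℤ.+ coeff q n         ≡⟨ coeff-+ ((ℤ.- + 4) · q) (0ℤ ∷ q) (suc n) ⟨
      coeff ((ℤ.- + 4) · q + (0ℤ ∷ q)) (suc n)            ≡⟨ coeff-≈ (X-4-* q) (suc n) ⟨
      coeff (X-4 * q) (suc n)                             ≡⟨ coeff-≈ (s*Q n) (suc n) ⟩
      coeff (P (suc n) + - P n) (suc n)                   ≡⟨ coeff-+ (P (suc n)) (- P n) (suc n) ⟩
      coeff (P (suc n)) (suc n) ℤ.+ coeff (- P n) (suc n)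
        ≡⟨ ≡.cong₂ ℤ._+_ (coeff-P-leading (suc n)) (≡.trans (coeff-neg (P n) (suc n)) (≡.cong ℤ.-_ (coeff-P-above n (suc n) ℕₚ.≤-refl))) ⟩
      1ℤ                                                  ∎

    eq : coeff q n ≡ 1ℤ ℤ.+ + 4 ℤ.* coeff q (suc n)
    eq = ≡.trans (solve 2 (λ a b → b := (con (ℤ.- + 4) :* a :+ b) :+ con (+ 4) :* a) ≡.refl (coeff q (suc n)) (coeff q n))
      (≡.cong (ℤ._+ + 4 ℤ.* coeff q (suc n)) difference)

  P-eisenstein : ∀ n (prime : Prime (suc (n ℕ.* 2))) → PrimeModulus.Eisenstein prime n (P n)
  P-eisenstein n p-prime = record
    { bounded  = mkBounded (coeff-P-above n)
    ; lower    = λ k k<n → ≡.subst (+ p ∣_) (≡.sym (coeff-P n k)) (∣n⇒∣m*n (ε n ℤ.* ε k) (∣ᵤ⇒∣ (p∣h k k<n)))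
    ; leading  = λ p∣1 → contradiction (∣⇒∣ᵤ (≡.subst (+ p ∣_) (coeff-P-leading n) p∣1)) (ℕ.>⇒∤ p>1)
    -- The constant coefficient is ±(2n+1) = ±p, so a factor p² would leave p dividing ±1.
    ; constant = λ pp∣ → contradiction (∣⇒∣ᵤ (*-cancelʳ-∣ (+ p) {+ p} {ε n ℤ.* 1ℤ} (≡.subst (+ p ℤ.* + p ∣_)
        (≡.trans (coeff-P n 0) (≡.cong (λ x → ε n ℤ.* 1ℤ ℤ.* + x) (h-zero n))) pp∣)))
        (λ p∣ε → ℕ.>⇒∤ p>1 (≡.subst (p ℕ.∣_) (≡.trans (≡.cong ℤ.∣_∣ (ℤₚ.*-identityʳ (ε n))) (∣ε∣≡1 n)) p∣ε))
    }
    where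
    p = suc (n ℕ.* 2)

    p>1 : 1 < p
    p>1 = ℕ.nonTrivial⇒n>1 p ⦃ prime⇒nonTrivial p-prime ⦄

    ∣ε∣≡1 : ∀ k → ℤ.∣ ε k ∣ ≡ 1
    ∣ε∣≡1 zero    = ≡.refl
    ∣ε∣≡1 (suc k) = ≡.trans (ℤₚ.∣-i∣≡∣i∣ (ε k)) (∣ε∣≡1 k)

    p∣h : ∀ k → k < n → p ℕ.∣ h n k
    -- For k < n the odd number 2k + 1 is positive and below p, so the prime must divide the other
    -- factor.
    p∣h k k<n = [ (λ p∣ → contradiction p∣ (ℕ.>⇒∤ (s≤s (ℕₚ.*-monoˡ-< 2 k<n)))) , (λ p∣ → p∣) ]′
      (euclidsLemma (suc (k ℕ.* 2)) (h n k) p-prime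
        (≡.subst (p ℕ.∣_) (≡.sym (h-absorption n k)) (ℕ.m∣m*n ((n ℕ.+ k) choose (k ℕ.* 2)))))

-- The linear change of variable and the norm on K[x].

module SubstitutionIdentities (R : CommutativeRing 0ℓ 0ℓ) where
  open CommutativeRing R
  open IntegerCoefficientSolver R

  affine-inverseˡ : ∀ a α b t → a * α ≈ 1# → a * (α * (t - b)) + b ≈ t
  affine-inverseˡ a α b t aα≈1 = trans (+-congʳ (trans (sym (*-assoc a α _)) (*-congʳ aα≈1)))
    (solve 2 (λ b t → con 1ℤ :* (t :- b) :+ b := t) refl b t)

  affine-inverseʳ : ∀ a α b x → a * α ≈ 1# → α * (a * x + b - b) ≈ x
  affine-inverseʳ a α b x aα≈1 = trans
    (solve 4 (λ a α b x → α :* (a :* x :+ b :- b) := a :* α :* x) refl a α b x)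
    (trans (*-congʳ aα≈1) (*-identityˡ x))

  shift-back : ∀ y k → k + (y - k) * 1# ≈ y
  shift-back y k = solve 2 (λ y k → k :+ (y :- k) :* con 1ℤ := y) refl y k

-- The substitution x = (t − b)/a identifies K[x] with K[w][t]/(t² = s),
-- where s = w + κ.
module LinearSubstitution (K : CommutativeRing 0ℓ 0ℓ) (a α b κ : CommutativeRing.Carrier K)
  (aα≈1 : CommutativeRing._≈_ K (CommutativeRing._*_ K a α) (CommutativeRing.1# K)) where

  private module K = CommutativeRing K
  open PolynomialRing K
  open Constants K using (C-isRingHomomorphism)

  s d : Poly
  s = κ ∷ K.1# ∷ []
  d = C a * X + C b

  module E = QuadraticExtension commutativeRing s

  private
    C* : ∀ x y → C (x K.* y) ≈ C x * C y
    C* x y = ≈-sym (C-* x (C y))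

    CaCα≈1 : C a * C α ≈ C K.1#
    CaCα≈1 = ≈-trans (≈-sym (C* a α)) (∷-cong aα≈1 ≈-refl)

    constant : K.Carrier → E.Carrier
    constant c = E.embed (C c)

    module EH = RingHomomorphism.IsRingHomomorphism commutativeRing E.commutativeRing E.embed-isRingHomomorphism
    module T = CommutativeRing commutativeRing
    module S = CommutativeRing E.commutativeRing

  -- The image of x, which is (t - b)/a.
  τ : E.Carrier
  τ = constant α E.* (E.√s E.+ E.- constant b)

  constant-isRingHomomorphism : RingHomomorphism.IsRingHomomorphism K E.commutativeRing constant
  constant-isRingHomomorphism =
    Composition.isRingHomomorphism E.≈-trans C-isRingHomomorphism E.embed-isRingHomomorphism

  module Φ = Evaluation K E.commutativeRing constant constant-isRingHomomorphism τ
  module φ = RingHomomorphism.IsRingHomomorphism commutativeRing E.commutativeRing Φ.eval-isRingHomomorphism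

  φ : Poly → E.Carrier
  φ = Φ.eval

  φ-d : φ d E.≈ E.√s
  φ-d = begin
    φ (C a * X + C b)                            ≈⟨ φ.+-homo (C a * X) (C b) ⟩
    φ (C a * X) E.+ φ (C b)
      ≈⟨ E.+-cong {φ (C a * X)} {constant a E.* τ} {φ (C b)} {constant b}
           (E.≈-trans {φ (C a * X)} {φ (C a) E.* φ X} (φ.*-homo (C a) X)
             (E.*-cong {φ (C a)} {constant a} {φ X} {τ} (Φ.eval-C a) Φ.eval-X)) (Φ.eval-C b) ⟩
    constant a E.* τ E.+ constant b
      ≈⟨ SubstitutionIdentities.affine-inverseˡ E.commutativeRing (constant a) (constant α) (constant b) E.√s
           (E.≈-trans {constant a E.* constant α} {E.embed (C a * C α)} (E.≈-sym (EH.*-homo (C a) (C α))) (EH.⟦⟧-cong CaCα≈1)) ⟩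
    E.√s                                         ∎
    where open SetoidReasoning S.setoid

  -- For the way back, w has to go to d² - κ, so that s = w + κ goes to the square of d.
  module W = Evaluation K commutativeRing C C-isRingHomomorphism (d * d + - C κ)

  W-s : d * d ≈ W.eval s
  W-s = ≈-sym (≈-trans (+-congˡ (C κ) (*-congˡ (d * d + - C κ) (W.eval-C K.1#)))
    (SubstitutionIdentities.shift-back commutativeRing (d * d) (C κ)))

  module Ψ = QuadraticExtensionLift commutativeRing commutativeRing s W.eval W.eval-isRingHomomorphism d W-s
  module ψ = RingHomomorphism.IsRingHomomorphism E.commutativeRing commutativeRing Ψ.lift-isRingHomomorphism

  ψ : E.Carrier → Poly
  ψ = Ψ.lift

  ψ-constant : ∀ c → ψ (constant c) ≈ C c
  ψ-constant c = ≈-trans (Ψ.lift-embed (C c)) (W.eval-C c)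

  ψ-√s : ψ E.√s ≈ d
  ψ-√s = ≈-trans (*-congˡ d (W.eval-C K.1#)) (≈-trans (*-comm d (C K.1#)) (*-identityˡ d))

  ψ-τ : ψ τ ≈ X
  ψ-τ = begin
    ψ (constant α E.* (E.√s E.+ E.- constant b))       ≈⟨ ψ.*-homo (constant α) (E.√s E.+ E.- constant b) ⟩
    ψ (constant α) * ψ (E.√s E.+ E.- constant b)
      ≈⟨ *-cong (ψ-constant α) (≈-trans (ψ.+-homo E.√s (E.- constant b))
           (+-cong ψ-√s (≈-trans (ψ.-‿homo (constant b)) (-‿cong (ψ-constant b))))) ⟩
    C α * (C a * X + C b + - C b)                      ≈⟨ SubstitutionIdentities.affine-inverseʳ commutativeRing (C a) (C α) (C b) X CaCα≈1 ⟩
    X                                                  ∎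
    where open SetoidReasoning T.setoid

  X* : ∀ p → X * p ≈ K.0# ∷ p
  X* p = ≈-trans (0∷-* (C K.1#) p) (∷-cong K.refl (*-identityˡ p))

  ψ∘φ : ∀ p → ψ (φ p) ≈ p
  ψ∘φ []      = ψ.0#-homo
  ψ∘φ (c ∷ p) = begin
    ψ (constant c E.+ τ E.* φ p)         ≈⟨ ψ.+-homo (constant c) (τ E.* φ p) ⟩
    ψ (constant c) + ψ (τ E.* φ p)
      ≈⟨ +-cong (ψ-constant c) (≈-trans (ψ.*-homo τ (φ p)) (≈-trans (*-cong ψ-τ (ψ∘φ p)) (X* p))) ⟩
    C c + (K.0# ∷ p)                     ≈⟨ ∷-cong (K.+-identityʳ c) ≈-refl ⟩
    c ∷ p                                ∎
    where open SetoidReasoning T.setoid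

  N : Poly → Poly
  N p = E.norm (φ p)

  N-* : ∀ p q → N (p * q) ≈ N p * N q
  N-* p q = ≈-trans (E.norm-cong (φ.*-homo p q)) (E.norm-* (φ p) (φ q))

  -- The inverse is the conjugate divided by the norm; it is formed in the extension and brought
  -- back to K[x] by `ψ`.
  norm-unit : ∀ c p → C c * N p ≈ C K.1# → ∃ λ q → q * p ≈ C K.1#
  norm-unit c p cN≈1 = ψ u , (begin
    ψ u * p                 ≈⟨ *-congˡ (ψ u) (ψ∘φ p) ⟨
    ψ u * ψ (φ p)           ≈⟨ ψ.*-homo u (φ p) ⟨
    ψ (u E.* φ p)           ≈⟨ ψ.⟦⟧-cong {u E.* φ p} {E.embed (C K.1#)} u*φp≈1 ⟩
    ψ (E.embed (C K.1#))    ≈⟨ ψ.1#-homo ⟩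
    C K.1#                  ∎)
    where
    open SetoidReasoning T.setoid
    u = constant c E.* E.conjugate (φ p)

    u*φp≈1 : u E.* φ p E.≈ E.embed (C K.1#)
    u*φp≈1 = E.≈-trans {u E.* φ p} (E.*-assoc (constant c) (E.conjugate (φ p)) (φ p))
      (E.≈-trans {constant c E.* (E.conjugate (φ p) E.* φ p)}
        (E.*-cong {constant c} {constant c} (E.≈-refl {constant c}) (E.conjugate-* (φ p)))
        (E.≈-trans {constant c E.* E.embed (N p)} (E.≈-sym (EH.*-homo (C c) (N p))) (EH.⟦⟧-cong cN≈1)))

-- Passing between ℤ and ℚ by clearing denominators.

module RationalEmbedding where
  ι : ℤ → ℚ
  ι i = i ℚ./ 1

  private
    toℚᵘ-ι : ∀ i → ℚ.toℚᵘ (ι i) ℚᵘ.≃ mkℚᵘ i 0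
    toℚᵘ-ι i = ℚₚ.toℚᵘ-fromℚᵘ (mkℚᵘ i 0)

  ι-+ : ∀ i j → ι (i ℤ.+ j) ≡ ι i ℚ.+ ι j
  ι-+ i j = ℚₚ.toℚᵘ-injective (begin
    ℚ.toℚᵘ (ι (i ℤ.+ j))                      ≈⟨ toℚᵘ-ι (i ℤ.+ j) ⟩
    mkℚᵘ (i ℤ.+ j) 0                          ≈⟨ *≡* (≡.cong₂ (λ x y → (x ℤ.+ y) ℤ.* 1ℤ) (≡.sym (ℤₚ.*-identityʳ i)) (≡.sym (ℤₚ.*-identityʳ j))) ⟩
    mkℚᵘ i 0 ℚᵘ.+ mkℚᵘ j 0                    ≈⟨ ℚᵘₚ.+-cong (toℚᵘ-ι i) (toℚᵘ-ι j) ⟨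
    ℚ.toℚᵘ (ι i) ℚᵘ.+ ℚ.toℚᵘ (ι j)            ≈⟨ ℚₚ.toℚᵘ-homo-+ (ι i) (ι j) ⟨
    ℚ.toℚᵘ (ι i ℚ.+ ι j)                      ∎)
    where open SetoidReasoning ℚᵘₚ.≃-setoid

  ι-* : ∀ i j → ι (i ℤ.* j) ≡ ι i ℚ.* ι j
  ι-* i j = ℚₚ.toℚᵘ-injective (begin
    ℚ.toℚᵘ (ι (i ℤ.* j))                      ≈⟨ toℚᵘ-ι (i ℤ.* j) ⟩
    mkℚᵘ (i ℤ.* j) 0                          ≡⟨⟩
    mkℚᵘ i 0 ℚᵘ.* mkℚᵘ j 0                    ≈⟨ ℚᵘₚ.*-cong (toℚᵘ-ι i) (toℚᵘ-ι j) ⟨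
    ℚ.toℚᵘ (ι i) ℚᵘ.* ℚ.toℚᵘ (ι j)            ≈⟨ ℚₚ.toℚᵘ-homo-* (ι i) (ι j) ⟨
    ℚ.toℚᵘ (ι i ℚ.* ι j)                      ∎)
    where open SetoidReasoning ℚᵘₚ.≃-setoid

  ι-injective : ∀ {i j} → ι i ≡ ι j → i ≡ j
  ι-injective {i} {j} ιi≡ιj with ℚₚ.fromℚᵘ-injective {mkℚᵘ i 0} {mkℚᵘ j 0} ιi≡ιj
  ... | *≡* i*1≡j*1 = ≡.trans (≡.sym (ℤₚ.*-identityʳ i)) (≡.trans i*1≡j*1 (ℤₚ.*-identityʳ j))

  ι-isRingHomomorphism : RingHomomorphism.IsRingHomomorphism ℤₚ.+-*-commutativeRing ℚₚ.+-*-commutativeRing ι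
  ι-isRingHomomorphism = RingHomomorphism.isRingHomomorphism ℤₚ.+-*-commutativeRing ℚₚ.+-*-commutativeRing
    ι (≡.cong ι) ι-+ ι-* ≡.refl

  ι≢0 : ∀ {i} → i ≢ 0ℤ → ι i ≢ 0ℚ
  ι≢0 i≢0 ιi≡0 = i≢0 (ι-injective ιi≡0)

  clear-denominator : ∀ q → ∃ λ N → ∃ λ i → N ≢ 0ℤ × ι N ℚ.* q ≡ ι i
  clear-denominator q@(mkℚ n d-1 _) = + suc d-1 , n , (λ ()) , ℚₚ.toℚᵘ-injective (begin
    ℚ.toℚᵘ (ι (+ suc d-1) ℚ.* q)              ≈⟨ ℚₚ.toℚᵘ-homo-* (ι (+ suc d-1)) q ⟩
    ℚ.toℚᵘ (ι (+ suc d-1)) ℚᵘ.* mkℚᵘ n d-1    ≈⟨ ℚᵘₚ.*-cong (toℚᵘ-ι (+ suc d-1)) (ℚᵘₚ.≃-refl {mkℚᵘ n d-1}) ⟩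
    mkℚᵘ (+ suc d-1) 0 ℚᵘ.* mkℚᵘ n d-1        ≈⟨ *≡* (≡.trans (ℤₚ.*-identityʳ _) (≡.trans (ℤₚ.*-comm (+ suc d-1) n)
                                                      (≡.cong (λ k → n ℤ.* + k) (≡.sym (ℕₚ.*-identityˡ (suc d-1)))))) ⟩
    mkℚᵘ n 0                                  ≈⟨ toℚᵘ-ι n ⟨
    ℚ.toℚᵘ (ι n)                              ∎)
    where open SetoidReasoning ℚᵘₚ.≃-setoid

  inverse : ∀ q → q ≢ 0ℚ → ∃ λ r → r ℚ.* q ≡ 1ℚ
  inverse q q≢0 = ℚ.1/_ q ⦃ ℚ.≢-nonZero q≢0 ⦄ , ℚₚ.*-inverseˡ q ⦃ ℚ.≢-nonZero q≢0 ⦄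

module RationalPolynomials where
  open RationalEmbedding
  private module ℤP = IntegerPolynomials
  open PolynomialRing ℚₚ.+-*-commutativeRing
  open Degree ℚₚ.+-*-commutativeRing
  open CoefficientMap ℤₚ.+-*-commutativeRing ℚₚ.+-*-commutativeRing ι ι-isRingHomomorphism
  private module Euclid = EuclidsLemma ℚₚ.+-*-commutativeRing (ℚₚ._≟ 0ℚ) inverse

  toℚ[x]-injective : ∀ {p q} → map ι p ≈ map ι q → p ℤP.≈ q
  toℚ[x]-injective {p} {q} e .ℤP.coeff-≈ k =
    ι-injective (≡.trans (≡.sym (coeff-map p k)) (≡.trans (coeff-≈ e k) (coeff-map q k)))

  clear-denominators : ∀ p → ∃ λ N → ∃ λ q → N ≢ 0ℤ × map ι q ≈ C (ι N) * p
  clear-denominators [] = 1ℤ , [] , (λ ()) , ≈-sym (*-zeroʳ (C 1ℚ))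
  clear-denominators (a ∷ p) with clear-denominator a | clear-denominators p
  ... | M , i , M≢0 , Ma≡i | N , q , N≢0 , q≈Np =
    M ℤ.* N , N ℤ.* i ∷ M ℤP.· q ,
    (λ MN≡0 → [ M≢0 , N≢0 ]′ (ℤₚ.i*j≡0⇒i≡0∨j≡0 M MN≡0)) ,
    ≈-trans (∷-cong head tail) (≈-sym (C-* (ι (M ℤ.* N)) (a ∷ p)))
    where
    head : ι (N ℤ.* i) ≡ ι (M ℤ.* N) ℚ.* a
    head = begin
      ι (N ℤ.* i)              ≡⟨ ι-* N i ⟩
      ι N ℚ.* ι i              ≡⟨ ≡.cong (ι N ℚ.*_) Ma≡i ⟨
      ι N ℚ.* (ι M ℚ.* a)      ≡⟨ ℚₚ.*-assoc (ι N) (ι M) a ⟨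
      ι N ℚ.* ι M ℚ.* a        ≡⟨ ≡.cong (ℚ._* a) (ι-* N M) ⟨
      ι (N ℤ.* M) ℚ.* a        ≡⟨ ≡.cong (λ k → ι k ℚ.* a) (ℤₚ.*-comm N M) ⟩
      ι (M ℤ.* N) ℚ.* a        ∎
      where open ≡.≡-Reasoning

    tail : map ι (M ℤP.· q) ≈ ι (M ℤ.* N) · p
    tail = ≈-trans (map-· M q) (≈-trans (·-cong {ι M} ≡.refl (≈-trans q≈Np (C-* (ι N) p)))
      (≈-trans (≈-sym (·-assoc (ι M) (ι N) p)) (·-cong {p = p} (≡.sym (ι-* M N)) ≈-refl)))

  private
    Bounded-descends : ∀ {n N u x} → N ≢ 0ℤ → map ι u ≈ C (ι N) * x → ℤP.Bounded n u → Bounded n x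
    Bounded-descends {N = N} {u} {x} N≢0 u≈Nx b .coeff-≥ k n≤k =
      [ (λ ιN≡0 → contradiction ιN≡0 (ι≢0 N≢0)) , id ]′ (Euclid.*≈0⇒ {ι N} {coeff x k} (begin
        ι N ℚ.* coeff x k       ≡⟨ coeff-C* (ι N) x k ⟨
        coeff (C (ι N) * x) k   ≡⟨ coeff-≈ u≈Nx k ⟨
        coeff (map ι u) k       ≡⟨ coeff-map u k ⟩
        ι (ℤP.coeff u k)        ≡⟨ ≡.cong ι (ℤP.coeff-≥ b k n≤k) ⟩
        0ℚ                      ∎))
      where open ≡.≡-Reasoning

  -- Denominators N and M of the two factors turn a factorisation of g into N M g = u v over ℤ,
  -- which the integral criterion with its scalar covers.
  eisenstein-irreducible : ∀ {p m g} (p-prime : Prime p) → ℤP.PrimeModulus.Eisenstein p-prime m g → 0 < m →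
                           Euclid.Irreducible (map ι g)
  eisenstein-irreducible {p} {m} {g} p-prime eisenstein 0<m x y g≈xy
    with clear-denominators x | clear-denominators y
  ... | N , u , N≢0 , u≈Nx | M , v , M≢0 , v≈My =
    Sum.map (Bounded-descends N≢0 u≈Nx) (Bounded-descends M≢0 v≈My)
      (ℤP.PrimeModulus.eisenstein-irreducible p-prime eisenstein 0<m (N ℤ.* M)
        (λ NM≡0 → [ N≢0 , M≢0 ]′ (ℤₚ.i*j≡0⇒i≡0∨j≡0 N NM≡0)) u v (toℚ[x]-injective (begin
          map ι (ℤP.C (N ℤ.* M) ℤP.* g)            ≈⟨ map-* (ℤP.C (N ℤ.* M)) g ⟩
          C (ι (N ℤ.* M)) * map ι g                ≈⟨ *-cong (≈-trans (∷-cong (ι-* N M) ≈-refl) (≈-sym (C-* (ι N) (C (ι M))))) g≈xy ⟩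
          C (ι N) * C (ι M) * (x * y)              ≈⟨ interchange (C (ι N)) (C (ι M)) x y ⟩
          C (ι N) * x * (C (ι M) * y)              ≈⟨ *-cong u≈Nx v≈My ⟨
          map ι u * map ι v                        ≈⟨ map-* u v ⟨
          map ι (u ℤP.* v)                         ∎)))
    where
    open SetoidReasoning (CommutativeRing.setoid commutativeRing)
    open import Algebra.Properties.CommutativeSemigroup
      (CommutativeRing.*-commutativeSemigroup commutativeRing) using (interchange)

-- Excluding scalar multiples of P n as norms.

module ScalingIdentity (R : CommutativeRing 0ℓ 0ℓ) where
  open CommutativeRing R
  open IntegerCoefficientSolver R

  scale-norm : ∀ s u v e o → (v * (u * e)) * (v * (u * e)) - s * ((u * (v * o)) * (u * (v * o))) ≈
               (u * v) * (u * v) * (e * e - s * (o * o))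
  scale-norm = solve 5 (λ s u v e o →
    (v :* (u :* e)) :* (v :* (u :* e)) :- s :* ((u :* (v :* o)) :* (u :* (v :* o))) :=
    (u :* v) :* (u :* v) :* (e :* e :- s :* (o :* o))) refl

module NormComparison where
  open import Data.Integer.Divisibility.Signed using (_∣_)
  open RationalEmbedding
  open RationalPolynomials
  private module ℤP = IntegerPolynomials
  open SquareParity using (X-4; no-proportional-norm)
  open PolynomialRing ℚₚ.+-*-commutativeRing
  open CoefficientMap ℤₚ.+-*-commutativeRing ℚₚ.+-*-commutativeRing ι ι-isRingHomomorphism
  private
    module Euclid = EuclidsLemma ℚₚ.+-*-commutativeRing (ℚₚ._≟ 0ℚ) inverse
    module At4ℤ = Evaluation ℤₚ.+-*-commutativeRing ℤₚ.+-*-commutativeRing id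
      (Identity.isRingHomomorphism (CommutativeRing.rawRing ℤₚ.+-*-commutativeRing) ≡.refl) (+ 4)
    module At4ℚ = Evaluation ℚₚ.+-*-commutativeRing ℚₚ.+-*-commutativeRing id
      (Identity.isRingHomomorphism (CommutativeRing.rawRing ℚₚ.+-*-commutativeRing) ≡.refl) (ι (+ 4))
    module at4ℤ = RingHomomorphism.IsRingHomomorphism ℤP.commutativeRing ℤₚ.+-*-commutativeRing At4ℤ.eval-isRingHomomorphism

  -- At w = 4 one has s = 0, that is t = 0: a norm E² - sO² becomes the square of a number, and each
  -- P n becomes F₂ₙ₊₁(0) = 1.
  at4 : ℤP.Poly → ℤ
  at4 = At4ℤ.eval

  private
    at4-map : ∀ p → At4ℚ.eval (map ι p) ≡ ι (at4 p)
    at4-map []      = ≡.refl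
    at4-map (a ∷ p) = ≡.trans (≡.cong (λ x → ι a ℚ.+ ι (+ 4) ℚ.* x) (at4-map p))
      (≡.sym (≡.trans (ι-+ a (+ 4 ℤ.* at4 p)) (≡.cong (λ x → ι a ℚ.+ x) (ι-* (+ 4) (at4 p)))))

  at4-X-4* : ∀ p → at4 (X-4 ℤP.* p) ≡ 0ℤ
  at4-X-4* p = ≡.trans (at4ℤ.*-homo X-4 p) (ℤₚ.*-zeroˡ (at4 p))

  at4-+ : ∀ p q → at4 (p ℤP.+ q) ≡ at4 p ℤ.+ at4 q
  at4-+ = at4ℤ.+-homo

  -- The value at w = 4 shows that the factor c is a square e²/n².
  norm≉scalar-multiple : ∀ g P Q j → g ℤP.≈ P ℤP.* P ℤP.+ X-4 ℤP.* (Q ℤP.* Q) → ¬ + 2 ∣ ℤP.coeff Q j →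
    at4 g ≡ 1ℤ → ∀ e o c → ¬ e * e + - (map ι X-4 * (o * o)) ≈ [] →
    ¬ e * e + - (map ι X-4 * (o * o)) ≈ C c * map ι g
  norm≉scalar-multiple g P Q j g≈ ∤Qⱼ g[4]≡1 e o c norm≉0 norm≈cg
    with clear-denominators e | clear-denominators o
  ... | N , e₁ , N≢0 , e₁≈Ne | M , o₁ , M≢0 , o₁≈Mo =
    no-proportional-norm P Q j ∤Qⱼ k k≢0 E O (ℤP.≈-trans Z≈kkg (ℤP.*-cong (ℤP.≈-sym (ℤP.C-* k (ℤP.C k))) g≈))
    where
    open ScalingIdentity commutativeRing
    module T = CommutativeRing commutativeRing
    E O Z : ℤP.Poly
    -- Each component is scaled by the denominator of the other, so that both carry the factor N M
    -- and the norm is multiplied by (N M)².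
    E = ℤP.C M ℤP.* e₁
    O = ℤP.C N ℤP.* o₁
    Z = E ℤP.* E ℤP.+ ℤP.- (X-4 ℤP.* (O ℤP.* O))
    k = at4 E
    s = map ι X-4
    n = ι N ℚ.* ι M
    r = n ℚ.* n ℚ.* c

    E≈ : map ι E ≈ C (ι M) * (C (ι N) * e)
    E≈ = ≈-trans (map-* (ℤP.C M) e₁) (*-congˡ (C (ι M)) e₁≈Ne)

    O≈ : map ι O ≈ C (ι N) * (C (ι M) * o)
    O≈ = ≈-trans (map-* (ℤP.C N) o₁) (*-congˡ (C (ι N)) o₁≈Mo)

    module mapι = RingHomomorphism.IsRingHomomorphism ℤP.commutativeRing commutativeRing map-isRingHomomorphism

    Z≈rg : map ι Z ≈ C r * map ι g
    Z≈rg = begin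
      map ι Z
        ≈⟨ mapι.+-homo (E ℤP.* E) (ℤP.- (X-4 ℤP.* (O ℤP.* O))) ⟩
      map ι (E ℤP.* E) + map ι (ℤP.- (X-4 ℤP.* (O ℤP.* O)))
        ≈⟨ +-cong (map-* E E) (≈-trans (mapι.-‿homo (X-4 ℤP.* (O ℤP.* O)))
             (-‿cong (≈-trans (map-* X-4 (O ℤP.* O)) (*-congˡ s (map-* O O))))) ⟩
      map ι E * map ι E + - (s * (map ι O * map ι O))
        ≈⟨ +-cong (*-cong E≈ E≈) (-‿cong (*-congˡ s (*-cong O≈ O≈))) ⟩
      _
        ≈⟨ scale-norm s (C (ι N)) (C (ι M)) e o ⟩
      (C (ι N) * C (ι M)) * (C (ι N) * C (ι M)) * (e * e + - (s * (o * o)))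
        ≈⟨ *-cong (≈-trans (*-cong NM NM) (C-* n (C n))) norm≈cg ⟩
      C (n ℚ.* n) * (C c * map ι g)
        ≈⟨ *-assoc (C (n ℚ.* n)) (C c) (map ι g) ⟨
      C (n ℚ.* n) * C c * map ι g
        ≈⟨ *-congʳ (map ι g) (C-* (n ℚ.* n) (C c)) ⟩
      C r * map ι g ∎
      where
      open SetoidReasoning T.setoid
      NM : C (ι N) * C (ι M) ≈ C n
      NM = C-* (ι N) (C (ι M))

    Z[4] : at4 Z ≡ k ℤ.* k
    Z[4] = ≡.trans (at4ℤ.+-homo (E ℤP.* E) (ℤP.- (X-4 ℤP.* (O ℤP.* O))))
      (≡.trans (≡.cong₂ ℤ._+_ (at4ℤ.*-homo E E) (≡.trans (at4ℤ.-‿homo (X-4 ℤP.* (O ℤP.* O))) (≡.cong ℤ.-_ (at4-X-4* (O ℤP.* O)))))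
        (ℤₚ.+-identityʳ (k ℤ.* k)))

    r≡kk : r ≡ ι (k ℤ.* k)
    r≡kk = begin
      r                                          ≡⟨ ℚₚ.*-identityʳ r ⟨
      r ℚ.* ι 1ℤ                                 ≡⟨ ≡.cong (λ x → r ℚ.* ι x) g[4]≡1 ⟨
      r ℚ.* ι (at4 g)                            ≡⟨ ≡.cong (r ℚ.*_) (at4-map g) ⟨
      r ℚ.* At4ℚ.eval (map ι g)                  ≡⟨ ≡.cong (ℚ._* At4ℚ.eval (map ι g)) (At4ℚ.eval-C r) ⟨
      At4ℚ.eval (C r) ℚ.* At4ℚ.eval (map ι g)    ≡⟨ At4ℚ.eval-* (C r) (map ι g) ⟨
      At4ℚ.eval (C r * map ι g)                  ≡⟨ At4ℚ.eval-cong Z≈rg ⟨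
      At4ℚ.eval (map ι Z)                        ≡⟨ at4-map Z ⟩
      ι (at4 Z)                                  ≡⟨ ≡.cong ι Z[4] ⟩
      ι (k ℤ.* k)                                ∎
      where open ≡.≡-Reasoning

    Z≈kkg : Z ℤP.≈ ℤP.C (k ℤ.* k) ℤP.* g
    Z≈kkg = toℚ[x]-injective (≈-trans Z≈rg (≈-trans (*-congʳ (map ι g) (∷-cong r≡kk (≈-refl {[]})))
      (≈-sym (map-* (ℤP.C (k ℤ.* k)) g))))

    k≢0 : k ≢ 0ℤ
    k≢0 k≡0 = [ (λ nn≡0 → [ n≢0 , n≢0 ]′ (Euclid.*≈0⇒ {n} {n} nn≡0)) , c≢0 ]′ (Euclid.*≈0⇒ {n ℚ.* n} {c}
      (≡.trans r≡kk (≡.cong (λ x → ι (x ℤ.* x)) k≡0)))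
      where
      n≢0 : n ≢ 0ℚ
      n≢0 n≡0 = [ ι≢0 N≢0 , ι≢0 M≢0 ]′ (Euclid.*≈0⇒ {ι N} {ι M} n≡0)

      c≢0 : c ≢ 0ℚ
      c≢0 c≡0 = norm≉0 (≈-trans norm≈cg (≈[]⇒*≈[] {C c} (≈-trans (∷-cong c≡0 (≈-refl {[]})) 0∷[]≈[]) (map ι g)))

-- Irreducibility of the Fibonacci polynomials of prime index.

halve-index : ∀ n → ∃ λ k → n ≡ k ℕ.* 2 ⊎ n ≡ suc (k ℕ.* 2)
halve-index zero = 0 , inj₁ ≡.refl
halve-index (suc n) with halve-index n
... | k , inj₁ e = k , inj₂ (≡.cong suc e)
... | k , inj₂ e = suc k , inj₁ (≡.cong suc e)

module Irreducibility (a b : ℤ) (a≢0 : a ≢ 0ℤ) where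
  open RationalEmbedding
  open RationalPolynomials
  open NormComparison
  private module ℤP = IntegerPolynomials
  open SquareParity using (X-4)
  open CoefficientFormula
  open PolynomialRing ℚₚ.+-*-commutativeRing
  open Degree ℚₚ.+-*-commutativeRing
  open CoefficientMap ℤₚ.+-*-commutativeRing ℚₚ.+-*-commutativeRing ι ι-isRingHomomorphism
  private
    module Euclid = EuclidsLemma ℚₚ.+-*-commutativeRing (ℚₚ._≟ 0ℚ) inverse

    α : ℚ
    α = proj₁ (inverse (ι a) (ι≢0 a≢0))

    aα≡1 : ι a ℚ.* α ≡ 1ℚ
    aα≡1 = ≡.trans (ℚₚ.*-comm (ι a) α) (proj₂ (inverse (ι a) (ι≢0 a≢0)))

  open LinearSubstitution ℚₚ.+-*-commutativeRing (ι a) α (ι b) (ι (ℤ.- + 4)) aα≡1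

  private
    module S = CommutativeRing E.commutativeRing

    dℤ : ℤP.Poly
    dℤ = ℤP.C a ℤP.* ℤP.X ℤP.+ ℤP.C b

    F : ℕ → ℤP.Poly
    F = fibonacciType dℤ (ℤP.C 1ℤ)

    f : ℕ → Poly
    f n = map ι (F n)

  map-d : map ι dℤ ≈ d
  map-d = ≈-trans (map-+ (ℤP.C a ℤP.* ℤP.X) (ℤP.C b)) (+-congʳ (C (ι b)) (map-* (ℤP.C a) ℤP.X))

  φ-fibonacci-step : ∀ n → φ (f (suc (suc n))) E.≈ (E.√s E.* φ (f (suc n))) E.+ φ (f n)
  φ-fibonacci-step n = begin
    φ (f (suc (suc n)))                           ≈⟨ φ.⟦⟧-cong step ⟩
    φ (d * f (suc n) + f n)                       ≈⟨ φ.+-homo (d * f (suc n)) (f n) ⟩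
    φ (d * f (suc n)) E.+ φ (f n)
      ≈⟨ S.+-congʳ {φ (f n)} {φ (d * f (suc n))} {E.√s E.* φ (f (suc n))} (E.≈-trans {φ (d * f (suc n))} (φ.*-homo d (f (suc n)))
           (S.*-congʳ {φ (f (suc n))} {φ d} {E.√s} φ-d)) ⟩
    (E.√s E.* φ (f (suc n))) E.+ φ (f n)          ∎
    where
    open SetoidReasoning S.setoid
    step : f (suc (suc n)) ≈ d * f (suc n) + f n
    step = ≈-trans (map-+ (dℤ ℤP.* F (suc n)) (ℤP.C 1ℤ ℤP.* F n))
      (+-cong (≈-trans (map-* dℤ (F (suc n))) (*-congʳ (f (suc n)) map-d)) (map-cong (ℤP.*-identityˡ (F n))))

  -- Multiplication by √s exchanges the two components, up to a factor s. Hence even indices live in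
  -- the second and odd ones in the first, and the Fibonacci step becomes the mutual recursion of
  -- `Q` and `P`.
  φ-fibonacci : ∀ n → φ (f (n ℕ.* 2)) E.≈ ([] , map ι (Q n)) × φ (f (suc (n ℕ.* 2))) E.≈ E.embed (map ι (P n))
  φ-fibonacci zero    = E.≈-refl {E.embed []} , φ.1#-homo
  φ-fibonacci (suc n) = even , odd
    where
    open SetoidReasoning S.setoid
    even : φ (f (suc n ℕ.* 2)) E.≈ ([] , map ι (Q (suc n)))
    even = begin
      φ (f (suc n ℕ.* 2))                                       ≈⟨ φ-fibonacci-step (n ℕ.* 2) ⟩
      (E.√s E.* φ (f (suc (n ℕ.* 2)))) E.+ φ (f (n ℕ.* 2))
        ≈⟨ S.+-cong {E.√s E.* φ (f (suc (n ℕ.* 2)))} {s * [] , map ι (P n)} {φ (f (n ℕ.* 2))} {[] , map ι (Q n)}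
             (E.≈-trans {E.√s E.* φ (f (suc (n ℕ.* 2)))} (S.*-congˡ {E.√s} {φ (f (suc (n ℕ.* 2)))} {E.embed (map ι (P n))} (proj₂ (φ-fibonacci n)))
               (E.√s-* (map ι (P n)) []))
             (proj₁ (φ-fibonacci n)) ⟩
      (s * [] + [] , map ι (P n) + map ι (Q n))
        ≈⟨ ≈-trans (+-identityʳ (s * [])) (*-zeroʳ s) , ≈-sym (map-+ (P n) (Q n)) ⟩
      ([] , map ι (Q (suc n)))                                  ∎

    odd : φ (f (suc (suc n ℕ.* 2))) E.≈ E.embed (map ι (P (suc n)))
    odd = begin
      φ (f (suc (suc n ℕ.* 2)))                                 ≈⟨ φ-fibonacci-step (suc (n ℕ.* 2)) ⟩
      (E.√s E.* φ (f (suc n ℕ.* 2))) E.+ φ (f (suc (n ℕ.* 2)))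
        ≈⟨ S.+-cong {E.√s E.* φ (f (suc n ℕ.* 2))} {s * map ι (Q (suc n)) , []} {φ (f (suc (n ℕ.* 2)))} {E.embed (map ι (P n))}
             (E.≈-trans {E.√s E.* φ (f (suc n ℕ.* 2))} (S.*-congˡ {E.√s} {φ (f (suc n ℕ.* 2))} {[] , map ι (Q (suc n))} even)
               (E.√s-* [] (map ι (Q (suc n)))))
             (proj₂ (φ-fibonacci n)) ⟩
      (s * map ι (Q (suc n)) + map ι (P n) , [])
        ≈⟨ ≈-sym (≈-trans (map-+ (X-4 ℤP.* Q (suc n)) (P n)) (+-congʳ (map ι (P n)) (map-* X-4 (Q (suc n))))) , ≈-refl {[]} ⟩
      E.embed (map ι (P (suc n)))                               ∎

  open import Algebra.Definitions.RawMagma using (_,_)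
  open RawSemiringDefinitions (RawRing.rawSemiring ℚ[x].rawRing) using (Irreducible; mkIrred; _∣_)

  N-bounded⇒unit : ∀ p → Bounded 1 (N p) → ¬ N p ≈ [] → p ∣ C 1ℚ
  N-bounded⇒unit p bN N≉0 = proj₁ unit , proj₂ unit
    where
    N₀ = coeff (N p) 0

    N₀⁻¹ : ∃ λ c → c ℚ.* N₀ ≡ 1ℚ
    N₀⁻¹ = inverse N₀ λ N₀≡0 → N≉0 (Bounded-0 (Bounded-suc N₀≡0 bN))

    unit : ∃ λ q → q * p ≈ C 1ℚ
    unit = norm-unit (proj₁ N₀⁻¹) p (≈-trans (*-congˡ (C (proj₁ N₀⁻¹)) (Bounded-1 bN))
      (≈-trans (C-* (proj₁ N₀⁻¹) (C N₀)) (∷-cong (proj₂ N₀⁻¹) ≈-refl)))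

  -- A nonzero coefficient at a positive index makes N p nonconstant, so p is no unit, as the norm
  -- of a unit divides 1. In a factorisation both norms are nonzero because N p is, and a nonzero
  -- constant norm makes its factor a unit.
  irreducible-by-norm : ∀ p m → ¬ coeff (N p) (suc m) ≡ 0ℚ →
    (∀ x y → N x * N y ≈ N p → Bounded 1 (N x) ⊎ Bounded 1 (N y)) → Irreducible p
  irreducible-by-norm p m Nₘ≢0 split = mkIrred p∤1 split-∣1
    where
    Np≉0 : ¬ N p ≈ []
    Np≉0 e = Nₘ≢0 (coeff-≈ e (suc m))

    N-1 : N (C 1ℚ) ≈ C 1ℚ
    N-1 = ≈-trans (E.norm-cong φ.1#-homo) (≈-trans (E.norm-embed (C 1ℚ)) (*-identityˡ (C 1ℚ)))

    p∤1 : ¬ p ∣ C 1ℚ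
    p∤1 (q , qp≈1) = contradiction (coeff-≈ 1≈0 0) λ ()
      where
      NpNq≈1 : N p * N q ≈ C 1ℚ
      NpNq≈1 = ≈-trans (*-comm (N p) (N q)) (≈-trans (≈-sym (N-* q p)) (≈-trans (E.norm-cong (φ.⟦⟧-cong qp≈1)) N-1))

      Nq≈0 : N q ≈ []
      Nq≈0 = Bounded-0 (Euclid.Bounded-*⁻ {suc m} {0} (N p) (N q) Nₘ≢0
        (Bounded-≤ (s≤s z≤n) (Bounded-≈ (≈-sym NpNq≈1) (Bounded-C 1ℚ))))

      1≈0 : C 1ℚ ≈ []
      1≈0 = ≈-trans (≈-sym NpNq≈1) (≈-trans (*-congˡ (N p) Nq≈0) (*-zeroʳ (N p)))

    split-∣1 : ∀ {x y} → p ≈ x * y → x ∣ C 1ℚ ⊎ y ∣ C 1ℚ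
    split-∣1 {x} {y} p≈xy = Sum.map
      (λ bx → N-bounded⇒unit x bx λ Nx≈0 → Np≉0 (≈-trans (≈-sym NxNy≈Np) (≈[]⇒*≈[] Nx≈0 (N y))))
      (λ by → N-bounded⇒unit y by λ Ny≈0 → Np≉0 (≈-trans (≈-sym NxNy≈Np) (≈-trans (*-congˡ (N x) Ny≈0) (*-zeroʳ (N x)))))
      (split x y NxNy≈Np)
      where
      NxNy≈Np : N x * N y ≈ N p
      NxNy≈Np = ≈-sym (≈-trans (E.norm-cong (φ.⟦⟧-cong p≈xy)) (N-* x y))

  irreducible-√s : ∀ p → φ p E.≈ E.√s → Irreducible p
  irreducible-√s p φp≈√s = irreducible-by-norm p 0 N₁≢0 split
    where
    N-p : N p ≈ - s
    N-p = ≈-trans (E.norm-cong {φ p} {E.√s} φp≈√s) E.norm-√s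

    N₁≢0 : coeff (N p) 1 ≢ 0ℚ
    N₁≢0 e = contradiction (≡.trans (≡.sym (coeff-≈ N-p 1)) e) λ ()

    bounded : Bounded 2 (N p)
    bounded = Bounded-≈ (≈-sym N-p) (Bounded-neg (Bounded-∷ (ι (ℤ.- + 4)) (Bounded-C 1ℚ)))

    split : ∀ x y → N x * N y ≈ N p → Bounded 1 (N x) ⊎ Bounded 1 (N y)
    split x y e = Euclid.linear-factors (N x) (N y) (Bounded-≈ (≈-sym e) bounded)

  at4-P : ∀ n → at4 (P n) ≡ 1ℤ
  at4-P zero    = ≡.refl
  at4-P (suc n) = ≡.trans (at4-+ (X-4 ℤP.* Q (suc n)) (P n)) (≡.cong₂ ℤ._+_ (at4-X-4* (Q (suc n))) (at4-P n))

  -- Here F₂ₙ₊₃ = Fₙ₊₁² + Fₙ₊₂², where the parity of n decides which term has even index and so the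
  -- form s Q². The sign of s is opposite to the one in `norm`. The index `suc l` avoids Q 0 = 0,
  -- which has no odd coefficient.
  P-as-norm : ∀ n → ∃ λ k → ∃ λ l → P (suc n) ℤP.≈ P k ℤP.* P k ℤP.+ X-4 ℤP.* (Q (suc l) ℤP.* Q (suc l))
  P-as-norm n with halve-index n
  ... | k , inj₁ ≡.refl = k , k , P-odd k
  ... | k , inj₂ ≡.refl = suc k , k , P-even (suc k)

  -- The norm is the square of G, of degree 2(n+1), which is `suc (n ℕ.+ suc n)`. Of the ways to
  -- split G² into two norms, all but those with a constant norm make a norm proportional to G.
  irreducible-P : ∀ n → Prime (suc (suc n ℕ.* 2)) → ∀ p → φ p E.≈ E.embed (map ι (P (suc n))) → Irreducible p
  irreducible-P n odd-prime p φp≈P = irreducible-by-norm p (n ℕ.+ suc n) leading≢0 split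
    where
    G = map ι (P (suc n))

    N-p : N p ≈ G * G
    N-p = ≈-trans (E.norm-cong {φ p} {E.embed G} φp≈P) (E.norm-embed G)

    G-bounded : Bounded (suc (suc n)) G
    G-bounded = mkBounded λ k n<k → ≡.trans (coeff-map (P (suc n)) k) (≡.cong ι (coeff-P-above (suc n) k n<k))

    G-leading : coeff G (suc n) ≡ 1ℚ
    G-leading = ≡.trans (coeff-map (P (suc n)) (suc n)) (≡.cong ι (coeff-P-leading (suc n)))

    G-leading≢0 : coeff G (suc n) ≢ 0ℚ
    G-leading≢0 e = contradiction (≡.trans (≡.sym G-leading) e) λ ()

    leading≢0 : ¬ coeff (N p) (suc (n ℕ.+ suc n)) ≡ 0ℚ
    leading≢0 e = contradiction (≡.trans (≡.sym (≡.trans (coeff-≈ N-p (suc (n ℕ.+ suc n)))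
      (≡.trans (coeff-*-top (suc n) (suc n) G G G-bounded G-bounded) (≡.cong₂ ℚ._*_ G-leading G-leading)))) e) λ ()

    Np≉0 : ¬ N p ≈ []
    Np≉0 e = leading≢0 (coeff-≈ e (suc (n ℕ.+ suc n)))

    not-multiple : ∀ x → ¬ N x ≈ [] → ¬ (∃ λ c → N x ≈ C c * G)
    not-multiple x Nx≉0 (c , Nx≈cG) = let (k , l , eq) = P-as-norm n in norm≉scalar-multiple (P (suc n)) (P k) (Q (suc l)) l eq (Q-odd-coefficient l) (at4-P (suc n))
      (proj₁ (φ x)) (proj₂ (φ x)) c Nx≉0 Nx≈cG

    split : ∀ x y → N x * N y ≈ N p → Bounded 1 (N x) ⊎ Bounded 1 (N y)
    split x y e =
      [ [ inj₂ , (λ Nx≈cG → contradiction Nx≈cG (not-multiple x Nx≉0)) ]′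
      , [ inj₁ , (λ Ny≈cG → contradiction Ny≈cG (not-multiple y Ny≉0)) ]′
      ]′ (Euclid.square-factors (suc n) G G-bounded G-leading≢0
           (eisenstein-irreducible odd-prime (P-eisenstein (suc n) odd-prime) (s≤s z≤n)) (N x) (N y) (≈-trans e N-p))
      where
      Nx≉0 : ¬ N x ≈ []
      Nx≉0 Nx≈0 = Np≉0 (≈-trans (≈-sym e) (≈[]⇒*≈[] Nx≈0 (N y)))

      Ny≉0 : ¬ N y ≈ []
      Ny≉0 Ny≈0 = Np≉0 (≈-trans (≈-sym e) (≈-trans (*-congˡ (N x) Ny≈0) (*-zeroʳ (N x))))

  irreducible : ∀ p → Prime p → Irreducible (f p)
  irreducible p p-prime with halve-index p
  ... | zero  , inj₁ ≡.refl = contradiction p-prime ¬prime[0]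
  ... | zero  , inj₂ ≡.refl = contradiction p-prime ¬prime[1]
  ... | suc n , inj₂ ≡.refl = irreducible-P n p-prime (f p) (proj₂ (φ-fibonacci (suc n)))
  ... | suc n , inj₁ ≡.refl = irreducible-√s (f p)
    (E.≈-trans {φ (f p)} {[] , map ι (Q (suc n))} (proj₁ (φ-fibonacci (suc n)))
      (≈-refl {[]} , coeff-one (prime⇒irreducible p-prime (ℕ.n∣m*n (suc n)))))
    where
    -- An even prime equals its divisor 2, so n = 0; then Q 1 = 1, and the image under `φ` is √s
    -- itself.
    coeff-one : 2 ≡ 1 ⊎ 2 ≡ suc n ℕ.* 2 → map ι (Q (suc n)) ≈ C 1ℚ
    coeff-one (inj₂ 2≡p) = ≡.subst (λ k → map ι (Q k) ≈ C 1ℚ) (ℕₚ.*-cancelʳ-≡ 1 (suc n) 2 2≡p) ≈-refl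

proposition3p4 : (a b : ℤ) → a ≢ 0ℤ → (p : ℕ) → Prime p →
    IrreducibleOverℚ (fibonacciType (ℤ[x].C a ℤ[x].* ℤ[x].X ℤ[x].+ ℤ[x].C b) (ℤ[x].C 1ℤ) p)
proposition3p4 a b a≢0 = Irreducibility.irreducible a b a≢0
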